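{- Let $\mathbf{X}$, $\mathbf{A}$ be $\sigma$-structures and $k\ge1$. The following are equivalent: (1) $\mathrm{SA}^k(\mathbf{X},\mathbf{A})$ is feasible; (2) there exists a sequence of structures $\mathbf{Y}_0,\dots,\mathbf{Y}_n$ (of the signature of $\mathbf{X}^{*_k}$) with $\mathbf{Y}_0=\mathbf{X}^{*_k}$, $\mathbf{Y}_n=\mathbf{A}^{*_k}$, and for all $i=0,\dots,n-1$, $\mathbf{Y}_i\to\mathbf{Y}_{i+1}$ or $\mathbf{Y}_i\equiv_1\mathbf{Y}_{i+1}$; (3) there exist structures $\mathbf{Y}_1,\mathbf{Y}_2$ with $\mathbf{X}^{*_k}\to\mathbf{Y}_1$, $\mathbf{Y}_1\equiv_1\mathbf{Y}_2$, and $\mathbf{Y}_2\to\mathbf{A}^{*_k}$.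
   Context: A $\sigma$-structure $\mathbf{A}$ ($\sigma$ a finite set of relation symbols with arities) is a finite universe $A$ with non-empty relations $R^{\mathbf{A}}\subseteq A^{\operatorname{ar}(R)}$; $\mathbf{X}\to\mathbf{A}$ means there is a homomorphism (a map preserving every relation componentwise). For a tuple $\mathbf{x}$, $\{\mathbf{x}\}$ is its set of entries; $\mathcal{C}_{\mathbf{A}}$ is the set of formal expressions $R(\mathbf{a})$ with $\mathbf{a}\in R^{\mathbf{A}}$. For $\mathbf{a}\in A^j$ and $\mathbf{i}=(i_1,\dots,i_n)\in[j]^n$, $\pi_{\mathbf{i}}\mathbf{a}=(a_{i_1},\dots,a_{i_n})$. $\mathbf{A}^{*_k}$ has universe $\bigcup_{1\le j\le k}A^j\cup\mathcal{C}_{\mathbf{A}}$ and relations: unary $T_{j,S}=\{\mathbf{a}\in A^j:a_i=a_{i'}\ \forall i,i'\in S\}$ ($j\le k$, $S\subseteq[j]$); binary $T_{j,\mathbf{i}}=\{(\mathbf{a},\pi_{\mathbf{i}}\mathbf{a}):\mathbf{a}\in A^j\}$ ($j,j'\le k$, $\mathbf{i}\in[j]^{j'}$); unary $R_S=\{R(\mathbf{a}):\mathbf{a}\in R^{\mathbf{A}},a_i=a_{i'}\ \forall i,i'\in S\}$ ($R\in\sigma$, $S\subseteq[\operatorname{ar}(R)]$); binary $R_{\mathbf{i}}=\{(R(\mathbf{a}),\pi_{\mathbf{i}}\mathbf{a}):\mathbf{a}\in R^{\mathbf{A}}\}$ ($R\in\sigma$, $j\le k$, $\mathbf{i}\in[\operatorname{ar}(R)]^j$).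 $\equiv_1$: the factor graph of a structure $\mathbf{B}$ is the bipartite graph on $B\cup\mathcal{C}_{\mathbf{B}}$ with edges $\{b,R(\mathbf{b})\}$ for $b\in\{\mathbf{b}\}$, labelled $(S,R)$ with $S=\{i:b_i=b\}$; $\delta_0(v)$ is one fixed symbol for elements and another for constraints; $\delta_j(v)=\{\{(\text{label of }\{v,w\},\delta_{j-1}(w)):w\text{ adjacent to }v\}\}$; $\delta(v)=(\delta_j(v))_{j\ge0}$; $\mathbf{B}\equiv_1\mathbf{B}'$ iff the multisets of iterated degrees of all vertices of their factor graphs coincide. $\mathrm{SA}^k(\mathbf{X},\mathbf{A})$ has variables $p_V(f)\in[0,1]$ ($V\subseteq X$, $1\le|V|\le k$, $f:V\to A$) and $p_{R(\mathbf{x})}(f)\in[0,1]$ ($R(\mathbf{x})\in\mathcal{C}_{\mathbf{X}}$, $f:\{\mathbf{x}\}\to A$), subject to: $\sum_{f:V\to A}p_V(f)=1$; $p_U(f)=\sum_{g:V\to A,g|_U=f}p_V(g)$ for nonempty $U\subseteq V$, $|V|\le k$; $p_U(f)=\sum_{g:\{\mathbf{x}\}\to A,g|_U=f}p_{R(\mathbf{x})}(g)$ for $R(\mathbf{x})\in\mathcal{C}_{\mathbf{X}}$, nonempty $U\subseteq\{\mathbf{x}\}$, $|U|\le k$; $p_{R(\mathbf{x})}(f)=0$ whenever $f(\mathbf{x})\notin R^{\mathbf{A}}$. Feasible means having a rational solution. -}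

module Defs where

open import Level using (0ℓ)
open import Data.Nat using (ℕ; zero; suc; _≤_)
open import Data.Fin as F using (Fin; toℕ)
open import Data.Fin.Properties using (any?; all?)
open import Data.Fin.Subset using (Subset; _∈_; _⊆_; ∣_∣)
open import Data.Fin.Subset.Properties using (_∈?_)
open import Data.Vec using (Vec; []; _∷_; lookup; map; tabulate; zipWith)
open import Data.Vec.Properties using (≡-dec)
open import Data.Bool using (Bool; true; false; T; if_then_else_; _∧_)
open import Data.Bool.Properties using (T-irrelevant)
import Data.Bool as B
open import Data.Maybe using (Maybe; just; nothing; is-just)
open import Data.List using (List; []; _∷_; foldr; concatMap; allFin)
import Data.List as L
open import Data.Product using (Σ; ∃; _×_; _,_; proj₁; proj₂)
open import Data.Sum using (_⊎_; inj₁; inj₂)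
open import Data.Rational using (ℚ; 0ℚ; 1ℚ; _+_) renaming (_≤_ to _≤ℚ_)
open import Function.Bundles using (_↔_; Inverse)
open import Relation.Binary.PropositionalEquality using (_≡_; refl; cong)
open import Relation.Binary.Definitions using (DecidableEquality)
open import Relation.Nullary using (Dec; yes; no; ¬_)
open import Relation.Nullary.Decidable using (⌊_⌋; _→-dec_)

record Sig : Set₁ where
  field
    Sym : Set
    ar  : Sym → ℕ
open Sig public

record Structure (σ : Sig) : Set₁ where
  field
    U   : Set
    _≟_ : DecidableEquality U
    rel : (R : Sym σ) → Vec U (ar σ R) → Bool
open Structure public

IsFinite : ∀ {σ} → Structure σ → Set
IsFinite B = Σ ℕ λ n → U B ↔ Fin n

_⟶_ : ∀ {σ} → Structure σ → Structure σ → Set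
_⟶_ {σ} B C = Σ (U B → U C) λ f →
  ∀ R (b : Vec (U B) (ar σ R)) → T (rel B R b) → T (rel C R (map f b))

module FactorGraph {σ : Sig} (B : Structure σ) where
  Con : Set
  Con = Σ (Sym σ) λ R → Σ (Vec (U B) (ar σ R)) λ b → T (rel B R b)

  Vtx : Set
  Vtx = U B ⊎ Con

  occ : ∀ {n} → U B → Vec (U B) n → Bool
  occ u b = ⌊ any? (λ i → _≟_ B (lookup b i) u) ⌋

  tuple : (c : Con) → Vec (U B) (ar σ (proj₁ c))
  tuple (_ , b , _) = b

  Nb : Vtx → Set
  Nb (inj₁ u) = Σ Con λ c → T (occ u (tuple c))
  Nb (inj₂ c) = Σ (U B) λ u → T (occ u (tuple c))

  tgt : (v : Vtx) → Nb v → Vtx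
  tgt (inj₁ u) (c , _) = inj₂ c
  tgt (inj₂ c) (u , _) = inj₁ u

  δ₀ : Vtx → Bool
  δ₀ (inj₁ _) = true
  δ₀ (inj₂ _) = false

Label : Sig → Set
Label σ = Σ (Sym σ) λ R → Subset (ar σ R)

module _ {σ : Sig} (B : Structure σ) where
  open FactorGraph B
  edgeLabel : U B → Con → Label σ
  edgeLabel u (R , b , _) = R , tabulate λ i → ⌊ _≟_ B (lookup b i) u ⌋

  lab : (v : Vtx) → Nb v → Label σ
  lab (inj₁ u) (c , _) = edgeLabel u c
  lab (inj₂ c) (u , _) = edgeLabel u c

-- δEq j v v' : δ_j(v) = δ_j(v') (v a vertex of the factor graph of B,
-- v' one of B').  Equality of the multisets
-- {{(label, δ_{j-1}(w)) : w adjacent}} is written out as the existence of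
-- a bijection between the neighbourhoods matching equal entries.
δEq : ∀ {σ} (B B' : Structure σ) → ℕ →
      FactorGraph.Vtx B → FactorGraph.Vtx B' → Set
δEq B B' zero v v' = FactorGraph.δ₀ B v ≡ FactorGraph.δ₀ B' v'
δEq B B' (suc j) v v' =
  Σ (FactorGraph.Nb B v ↔ FactorGraph.Nb B' v') λ ψ →
    ∀ e → (lab B v e ≡ lab B' v' (Inverse.to ψ e))
        × δEq B B' j (FactorGraph.tgt B v e)
                     (FactorGraph.tgt B' v' (Inverse.to ψ e))

-- B ≡₁ B' : the multisets {{δ(v)}} over all vertices coincide,
-- where δ(v) = (δ_j(v))_{j ≥ 0}.
_≡₁_ : ∀ {σ} → Structure σ → Structure σ → Set
B ≡₁ B' = Σ (FactorGraph.Vtx B ↔ FactorGraph.Vtx B') λ φ →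
  ∀ v (j : ℕ) → δEq B B' j v (Inverse.to φ v)

Step : ∀ {σ} → Structure σ → Structure σ → Set
Step Y Z = IsFinite Z × ((Y ⟶ Z) ⊎ (Y ≡₁ Z))

data Chain {σ : Sig} : Structure σ → Structure σ → Set₁ where
  []  : ∀ {Y} → Chain Y Y
  _∷_ : ∀ {Y Z W} → Step Y Z → Chain Z W → Chain Y W

record FinStr (m : ℕ) (ar : Fin m → ℕ) : Set where
  field
    size : ℕ
    relF : (R : Fin m) → Vec (Fin size) (ar R) → Bool

NonEmptyRels : ∀ {m ar} → FinStr m ar → Set
NonEmptyRels {m} {ar} 𝔸 =
  (R : Fin m) → ∃ λ (a : Vec (Fin (FinStr.size 𝔸)) (ar R)) → T (FinStr.relF 𝔸 R a)

-- tuple lengths 1..k are encoded by j : Fin k, meaning length len j = toℕ j + 1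
len : ∀ {k} → Fin k → ℕ
len j = suc (toℕ j)

π : ∀ {A : Set} {j j'} → Vec (Fin j) j' → Vec A j → Vec A j'
π i a = map (lookup a) i

EqOn : ∀ {A : Set} {n} → Subset n → Vec A n → Set
EqOn S a = ∀ i i' → i ∈ S → i' ∈ S → lookup a i ≡ lookup a i'

eqOn? : ∀ {A : Set} {n} → DecidableEquality A → (S : Subset n) (a : Vec A n) → Dec (EqOn S a)
eqOn? _≟_ S a = all? λ i → all? λ i' →
  (i ∈? S) →-dec ((i' ∈? S) →-dec (lookup a i ≟ lookup a i'))

data Sym* (m : ℕ) (ar : Fin m → ℕ) (k : ℕ) : Set where
  T₁ : (j : Fin k) → Subset (len j) → Sym* m ar k
  T₂ : (j j' : Fin k) → Vec (Fin (len j)) (len j') → Sym* m ar k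
  R₁ : (R : Fin m) → Subset (ar R) → Sym* m ar k
  R₂ : (R : Fin m) (j : Fin k) → Vec (Fin (ar R)) (len j) → Sym* m ar k

ar* : ∀ {m ar k} → Sym* m ar k → ℕ
ar* (T₁ _ _)   = 1
ar* (T₂ _ _ _) = 2
ar* (R₁ _ _)   = 1
ar* (R₂ _ _ _) = 2

σ* : (m : ℕ) (ar : Fin m → ℕ) (k : ℕ) → Sig
σ* m ar k = record { Sym = Sym* m ar k ; ar = ar* }

module Star {m : ℕ} {ar : Fin m → ℕ} (𝔸 : FinStr m ar) (k : ℕ) where
  open FinStr 𝔸

  data U* : Set where
    tup : (j : Fin k) → Vec (Fin size) (len j) → U*
    con : (R : Fin m) (a : Vec (Fin size) (ar R)) → T (relF R a) → U*

  _≟*_ : DecidableEquality U*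
  tup j a ≟* tup j' a' with j F.≟ j'
  ... | no ne = no λ { refl → ne refl }
  ... | yes refl with ≡-dec F._≟_ a a'
  ...   | yes refl = yes refl
  ...   | no ne = no λ { refl → ne refl }
  tup _ _ ≟* con _ _ _ = no λ ()
  con _ _ _ ≟* tup _ _ = no λ ()
  con R a t ≟* con R' a' t' with R F.≟ R'
  ... | no ne = no λ { refl → ne refl }
  ... | yes refl with ≡-dec F._≟_ a a'
  ...   | yes refl = yes (cong (con R a) (T-irrelevant t t'))
  ...   | no ne = no λ { refl → ne refl }

  relT₁ : (j : Fin k) → Subset (len j) → U* → Bool
  relT₁ j S (tup j' a) with j F.≟ j'
  ... | yes refl = ⌊ eqOn? F._≟_ S a ⌋
  ... | no _ = false
  relT₁ j S (con _ _ _) = false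

  relT₂ : (j j' : Fin k) → Vec (Fin (len j)) (len j') → U* → U* → Bool
  relT₂ j j' i (tup j₁ a) (tup j₂ b) with j F.≟ j₁ | j' F.≟ j₂
  ... | yes refl | yes refl = ⌊ ≡-dec F._≟_ b (π i a) ⌋
  ... | _ | _ = false
  relT₂ _ _ _ _ _ = false

  relR₁ : (R : Fin m) → Subset (ar R) → U* → Bool
  relR₁ R S (con R' a _) with R F.≟ R'
  ... | yes refl = ⌊ eqOn? F._≟_ S a ⌋
  ... | no _ = false
  relR₁ R S (tup _ _) = false

  relR₂ : (R : Fin m) (j : Fin k) → Vec (Fin (ar R)) (len j) → U* → U* → Bool
  relR₂ R j i (con R' a _) (tup j' b) with R F.≟ R' | j F.≟ j'
  ... | yes refl | yes refl = ⌊ ≡-dec F._≟_ b (π i a) ⌋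
  ... | _ | _ = false
  relR₂ _ _ _ _ _ = false

  rel* : (s : Sym* m ar k) → Vec U* (ar* s) → Bool
  rel* (T₁ j S)    (u ∷ [])     = relT₁ j S u
  rel* (T₂ j j' i) (u ∷ v ∷ []) = relT₂ j j' i u v
  rel* (R₁ R S)    (u ∷ [])     = relR₁ R S u
  rel* (R₂ R j i)  (u ∷ v ∷ []) = relR₂ R j i u v

  structure : Structure (σ* m ar k)
  structure = record { U = U* ; _≟_ = _≟*_ ; rel = rel* }

_*^_ : ∀ {m ar} → FinStr m ar → (k : ℕ) → Structure (σ* m ar k)
𝔸 *^ k = Star.structure 𝔸 k

-- The Sherali–Adams relaxation SA^k(X, A).
-- A pair (V, f : V → A) with V ⊆ X is encoded as a partial map
-- g : Vec (Maybe A) |X| with domain V.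

module SA {m : ℕ} {ar : Fin m → ℕ} (𝕏 𝔸 : FinStr m ar) (k : ℕ) where
  private
    n = FinStr.size 𝕏
    a = FinStr.size 𝔸

  PMap : Set
  PMap = Vec (Maybe (Fin a)) n

  dom : PMap → Subset n
  dom = map is-just

  restrict : Subset n → PMap → PMap
  restrict S g = zipWith (λ b x → if b then x else nothing) S g

  entries : ∀ {r} → Vec (Fin n) r → Subset n
  entries x = tabulate λ y → ⌊ any? (λ i → lookup x i F.≟ y) ⌋

  _=S_ : Subset n → Subset n → Bool
  S =S S' = ⌊ ≡-dec Data.Bool._≟_ S S' ⌋
    where import Data.Bool

  _=P_ : PMap → PMap → Bool
  g =P g' = ⌊ ≡-dec (Data.Maybe.Properties.≡-dec F._≟_) g g' ⌋
    where import Data.Maybe.Properties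

  allVecs : ∀ {A : Set} → List A → (r : ℕ) → List (Vec A r)
  allVecs xs zero    = [] ∷ []
  allVecs xs (suc r) = concatMap (λ x → L.map (x ∷_) (allVecs xs r)) xs

  allPMaps : List PMap
  allPMaps = allVecs (nothing ∷ L.map just (allFin a)) n

  sumOver : (PMap → Bool) → (PMap → ℚ) → ℚ
  sumOver c φ = foldr (λ g acc → if c g then φ g + acc else acc) 0ℚ allPMaps

  record Solution : Set where
    field
      -- p g = p_{dom g}(g);  q R x g = p_{R(x)}(g)
      p : PMap → ℚ
      q : (R : Fin m) → Vec (Fin n) (ar R) → PMap → ℚ
      p-range : ∀ g → 1 ≤ ∣ dom g ∣ → ∣ dom g ∣ ≤ k → (0ℚ ≤ℚ p g) × (p g ≤ℚ 1ℚ)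
      q-range : ∀ R x → T (FinStr.relF 𝕏 R x) → ∀ g → dom g ≡ entries x →
                (0ℚ ≤ℚ q R x g) × (q R x g ≤ℚ 1ℚ)
      sum-one : ∀ (V : Subset n) → 1 ≤ ∣ V ∣ → ∣ V ∣ ≤ k →
                sumOver (λ g → dom g =S V) p ≡ 1ℚ
      marg    : ∀ (U V : Subset n) → 1 ≤ ∣ U ∣ → U ⊆ V → ∣ V ∣ ≤ k →
                ∀ f → dom f ≡ U →
                p f ≡ sumOver (λ g → (dom g =S V) ∧ (restrict U g =P f)) p
      margC   : ∀ R x → T (FinStr.relF 𝕏 R x) →
                ∀ (U : Subset n) → 1 ≤ ∣ U ∣ → U ⊆ entries x → ∣ U ∣ ≤ k →
                ∀ f → dom f ≡ U →
                p f ≡ sumOver (λ g → (dom g =S entries x) ∧ (restrict U g =P f)) (q R x)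
      support : ∀ R x → T (FinStr.relF 𝕏 R x) → ∀ g → dom g ≡ entries x →
                ∀ (h : Vec (Fin a) (ar R)) → map just h ≡ map (lookup g) x →
                FinStr.relF 𝔸 R h ≡ false → q R x g ≡ 0ℚ

SAFeasible : ∀ {m ar} → FinStr m ar → FinStr m ar → ℕ → Set
SAFeasible 𝕏 𝔸 k = SA.Solution 𝕏 𝔸 k

ThreeStep : ∀ {σ} → Structure σ → Structure σ → Set₁
ThreeStep {σ} B C = Σ (Structure σ) λ Y₁ → Σ (Structure σ) λ Y₂ →
  IsFinite Y₁ × IsFinite Y₂ × (B ⟶ Y₁) × (Y₁ ≡₁ Y₂) × (Y₂ ⟶ C)

{-# OPTIONS --safe #-}
module Submission where

-- All conditions are compared with the existence of a random map from 𝕏 *^ k to 𝔸 *^ k whose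
-- law is uniform on a finite index set and under which every constraint is satisfied after
-- re-indexing its entries by permutations.  Such maps compose; homomorphisms are the one-point
-- case, and ≡₁ provides one by sending a vertex to a uniform vertex of the same colour.  So a
-- chain provides one, and its tuple and constraint marginals are an SA^k solution.  Conversely,
-- clearing denominators in a solution turns marginal equalities into permutations, and lifting
-- 𝕏 *^ k along these permutations gives a finite cover that maps to 𝔸 *^ k and is ≡₁ to the
-- trivial cover, which contains 𝕏 *^ k.

open import Defs
open import Axiom.UniquenessOfIdentityProofs.WithK using (uip)
open import Data.Bool using (Bool; true; false; T; T?; if_then_else_; _∧_; not)
open import Data.Bool.Properties as Bool using (T-irrelevant; T-∧; T-≡; T-not-≡)
open import Data.Empty using (⊥-elim)
open import Data.Fin as F using (Fin; zero; suc)
open import Data.Fin.Permutation using (insert; remove; insert-punchIn; punchIn-permute; ↔⇒≡)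
open import Data.Fin.Properties as Fin using (any?; all?; +↔⊎; *↔×; ¬∀⟶∃¬)
open import Data.Fin.Subset using (Subset; ∣_∣; _⊂_; _⊆_; ⁅_⁆; _∪_; ⊥; Nonempty) renaming (_∈_ to _∈ₛ_)
open import Data.Fin.Subset.Properties using (p⊂q⇒∣p∣<∣q∣; x∈⁅x⁆; x∈p∪q⁺; x∈p∪q⁻; x∈⁅y⁆⇒x≡y; p⊆q⇒∣p∣≤∣q∣; ∣⊥∣≡0; ∉⊥; ∪-identityˡ; ∣p∣≤∣x∷p∣; ∣⁅x⁆∣≡1; _∈?_)
open import Data.Integer as ℤ using (-[1+_])
open import Data.Integer.Properties as ℤ using ()
open import Data.List as List using (List; []; _∷_; _++_; foldr; concatMap; length)
open import Data.List.Properties using (map-tabulate)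
open import Data.Maybe using (Maybe; just; nothing; is-just)
open import Data.Maybe.Properties using (just-injective) renaming (≡-dec to Maybe-≡-dec)
open import Data.Nat as ℕ using (ℕ; zero; suc; _*_; NonZero; _<_; s≤s; _≤_; z≤n; _≤?_; _+_)
open import Data.Nat.Divisibility using (_∣_; ∣-trans; m∣m*n; n∣m*n; divides; quotient)
open import Data.Nat.Properties as ℕ using (m*n≢0; *-cancelʳ-≡; ≤-trans; n<1+n; ≤-reflexive)
open import Data.Product using (Σ; ∃; _×_; _,_; proj₁; proj₂)
open import Data.Product.Algebra using (×-comm; ×-assoc)
open import Data.Product.Function.Dependent.Propositional as ΣCong using ()
open import Data.Product.Function.NonDependent.Propositional using (_×-↔_)
open import Data.Rational as ℚ using (ℚ; 0ℚ; 1ℚ; mkℚ; ↧ₙ_; toℚᵘ)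
open import Data.Rational.Properties as ℚ using (toℚᵘ-homo-+; toℚᵘ-homo-*; toℚᵘ-injective)
open import Data.Rational.Unnormalised as ℚᵘ using (ℚᵘ; mkℚᵘ; _≃_; *≡*)
open import Data.Rational.Unnormalised.Properties as ℚᵘ using (≃-trans; ≃-sym)
open import Data.Sum using (_⊎_; inj₁; inj₂)
open import Data.Sum.Function.Propositional using (_⊎-↔_)
open import Data.Unit using (tt; ⊤)
open import Data.Vec using (Vec; []; _∷_; head; tail; lookup; map; tabulate; here; there; replicate)
open import Data.Vec.Properties using (lookup∘tabulate; tabulate∘lookup; tabulate-cong; tabulate-∘; lookup⇒[]=; []=⇒lookup; lookup-map; lookup-zipWith; ≡-dec; ∷-injectiveˡ; ∷-injectiveʳ; lookup-replicate)
open import Function using (_∘_; const)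
open import Function.Bundles using (_↔_; mk↔ₛ′; Equivalence; _⇔_; mk⇔; Inverse)
open import Function.Construct.Composition using (_↔-∘_)
open import Function.Construct.Identity using (↔-id)
open import Function.Construct.Symmetry using (↔-sym)
open import Relation.Binary.Definitions using (DecidableEquality)
open import Relation.Binary.PropositionalEquality hiding (J)
open import Relation.Nullary using (Dec; yes; no; ¬_; Irrelevant)
open import Relation.Nullary.Decidable using (map′; _×-dec_; _→-dec_; ⌊_⌋; toWitness; fromWitness; isYes≗does; dec-true; True)
open import Algebra.Properties.CommutativeSemigroup ℕ.+-commutativeSemigroup using (interchange)
open import Algebra.Properties.Group ℚ.+-0-group using (∙-cancelˡ)

open Inverse using (to; from) renaming (strictlyInverseˡ to to-from; strictlyInverseʳ to from-to)
open FactorGraph using (Con; Vtx; Nb; tgt; δ₀; occ)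

-- All laws are uniform on finite index sets, so two variables have the same law exactly when a
-- permutation of indices carries one to the other. A separate permutation for each position of a
-- constraint is forced by the problem: SA^k couples the ends of each constraint, but there need be
-- no joint law on all of 𝕏. The passage from ≡₁ to a random map rests on double counting. In an
-- equitable partition, the number of constraints of a class with a given element at position i is
-- the same for all elements of that element's class, so a uniform constraint has uniform entries.
-- Iterated degrees are infinite sequences; finiteness supplies a single level that is already
-- stable, and stability makes the partition equitable. Lifting meets an obstacle of its own. Edge
-- labels record all positions of an element, so equal entries of a constraint must receive equal
-- permutations. In 𝕏 *^ k only a `T₂` constraint can repeat an entry, when it joins a tuple to a
-- projection equal to it, and then the identity can be chosen.

-- Finite types

to-injective : {A B : Set} (e : A ↔ B) {x y : A} → to e x ≡ to e y → x ≡ y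
to-injective e {x} {y} p = trans (sym (from-to e x)) (trans (cong (from e) p) (from-to e y))

Finite : Set → Set
Finite A = Σ ℕ λ n → A ↔ Fin n

card : {A : Set} → Finite A → ℕ
card = proj₁

finite-↔ : {A B : Set} → A ↔ B → Finite B → Finite A
finite-↔ e (n , f) = n , f ↔-∘ e

finite-⊎ : {A B : Set} → Finite A → Finite B → Finite (A ⊎ B)
finite-⊎ (m , e) (n , f) = _ , ↔-sym +↔⊎ ↔-∘ (e ⊎-↔ f)

finite-prop : {A : Set} → Dec A → Irrelevant A → Finite A
finite-prop (yes a) irr = 1 , mk↔ₛ′ (λ _ → zero) (λ _ → a) (λ { zero → refl }) (irr a)
finite-prop (no ¬a) irr = 0 , mk↔ₛ′ (λ a → ⊥-elim (¬a a)) (λ ()) (λ ()) (λ a → ⊥-elim (¬a a))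

finite-T : ∀ b → Finite (T b)
finite-T true  = finite-prop (yes tt) (λ _ _ → refl)
finite-T false = finite-prop (no λ ()) (λ ())

Σ-suc : ∀ {n} (B : Fin (suc n) → Set) → Σ (Fin (suc n)) B ↔ (B zero ⊎ Σ (Fin n) (B ∘ suc))
Σ-suc B = mk↔ₛ′
  (λ { (zero , b) → inj₁ b ; (suc i , b) → inj₂ (i , b) })
  (λ { (inj₁ b) → zero , b ; (inj₂ (i , b)) → suc i , b })
  (λ { (inj₁ _) → refl ; (inj₂ _) → refl })
  (λ { (zero , _) → refl ; (suc _ , _) → refl })

finite-ΣFin : ∀ n (B : Fin n → Set) → (∀ i → Finite (B i)) → Finite (Σ (Fin n) B)
finite-ΣFin zero    B fB = 0 , mk↔ₛ′ proj₁ (λ ()) (λ ()) (λ { (() , _) })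
finite-ΣFin (suc n) B fB =
  finite-↔ (Σ-suc B) (finite-⊎ (fB zero) (finite-ΣFin n (B ∘ suc) (fB ∘ suc)))

finite-Σ : {A : Set} {B : A → Set} → Finite A → (∀ a → Finite (B a)) → Finite (Σ A B)
finite-Σ {A} {B} (n , e) fB =
  finite-↔ (↔-sym (ΣCong.cong (↔-sym e) (λ {x} → ↔-id (B (from e x)))))
           (finite-ΣFin n (B ∘ from e) (fB ∘ from e))

finite-× : {A B : Set} → Finite A → Finite B → Finite (A × B)
finite-× fA fB = finite-Σ fA (λ _ → fB)

finite-Fin : ∀ n → Finite (Fin n)
finite-Fin n = n , ↔-id (Fin n)

finite-Vec : {A : Set} → Finite A → ∀ n → Finite (Vec A n)
finite-Vec fA zero    = finite-↔
  (mk↔ₛ′ (λ _ → tt) (λ _ → []) (λ _ → refl) (λ { [] → refl })) (finite-T true)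
finite-Vec fA (suc n) = finite-↔
  (mk↔ₛ′ (λ v → head v , tail v) (λ (x , xs) → x ∷ xs) (λ _ → refl) (λ { (_ ∷ _) → refl }))
  (finite-× fA (finite-Vec fA n))

finite-Bool : Finite Bool
finite-Bool = 2 , ↔-sym Fin.2↔Bool

abstract
  finite⇒dec≡ : {A : Set} → Finite A → DecidableEquality A
  finite⇒dec≡ (_ , e) x y = map′ (to-injective e) (cong (to e)) (to e x Fin.≟ to e y)

finite-≡ : {A : Set} → Finite A → (x y : A) → Finite (x ≡ y)
finite-≡ fA x y = finite-prop (finite⇒dec≡ fA x y) (λ { refl refl → refl })

Matching : {A B : Set} (P : A → B → Set) → Set
Matching {A} {B} P = Σ (A ↔ B) λ ψ → ∀ a → P a (to ψ a)

-- The partner of `zero` is searched among all `j`; deleting both and renumbering by `punchIn`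
-- leaves a smaller instance. Decidability of `δEq` rests on this search.
finMatching? : ∀ m n (P : Fin m → Fin n → Set) → (∀ i j → Dec (P i j)) → Dec (Matching P)
finMatching? zero zero P P? = yes (↔-id (Fin 0) , λ ())
finMatching? zero (suc n) P P? = no λ { (ψ , _) → Fin.¬Fin0 (from ψ zero) }
finMatching? (suc m) zero P P? = no λ { (ψ , _) → Fin.¬Fin0 (to ψ zero) }
finMatching? (suc m) (suc n) P P? =
  map′ glue split (any? λ j → P? zero j ×-dec finMatching? m n (Rest j) (λ i i' → P? _ _))
  where
  Rest : Fin (suc n) → Fin m → Fin n → Set
  Rest j i i' = P (suc i) (F.punchIn j i')
  glue : (∃ λ j → P zero j × Matching (Rest j)) → Matching P
  glue (j , p , ψ , h) = insert zero j ψ , λ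
    { zero → p
    ; (suc i) → subst (P (suc i)) (sym (insert-punchIn zero j ψ i)) (h i) }
  split : Matching P → ∃ λ j → P zero j × Matching (Rest j)
  split (ψ , h) = to ψ zero , h zero , remove zero ψ ,
    λ i → subst (P (suc i)) (punchIn-permute ψ zero i) (h (suc i))

matching? : {A B : Set} {P : A → B → Set} → Finite A → Finite B →
            (∀ a b → Dec (P a b)) → Dec (Matching P)
matching? {P = P} (m , e) (n , f) P? = map′
  (λ (ψ , h) → ↔-sym f ↔-∘ (ψ ↔-∘ e) ,
     λ a → subst (λ a' → P a' _) (from-to e a) (h (to e a)))
  (λ (ψ , h) → f ↔-∘ (ψ ↔-∘ ↔-sym e) ,
     λ i → subst (P (from e i)) (sym (from-to f _)) (h (from e i)))
  (finMatching? m n (λ i j → P (from e i) (from f j)) (λ i j → P? _ _))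

finite-↔⇒card≡ : {A B : Set} (fA : Finite A) (fB : Finite B) → A ↔ B → card fA ≡ card fB
finite-↔⇒card≡ (_ , e) (_ , f) ψ = ↔⇒≡ (f ↔-∘ (ψ ↔-∘ ↔-sym e))

card≡⇒↔ : {A B : Set} (fA : Finite A) (fB : Finite B) → card fA ≡ card fB → A ↔ B
card≡⇒↔ (_ , e) (_ , f) refl = ↔-sym f ↔-∘ e

nonempty⇒card≢0 : {A : Set} (fA : Finite A) → A → NonZero (card fA)
nonempty⇒card≢0 (zero  , e) a = ⊥-elim (Fin.¬Fin0 (to e a))
nonempty⇒card≢0 (suc _ , _) _ = _

finCommonMultiple : ∀ n (s : Fin n → ℕ) → (∀ i → NonZero (s i)) →
                    ∃ λ N → NonZero N × (∀ i → s i ∣ N)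
finCommonMultiple zero    s s≢0 = 1 , _ , λ ()
finCommonMultiple (suc n) s s≢0 with finCommonMultiple n (s ∘ suc) (s≢0 ∘ suc)
... | N , N≢0 , h = s zero * N , m*n≢0 (s zero) N {{s≢0 zero}} {{N≢0}} , λ
  { zero → m∣m*n N
  ; (suc i) → ∣-trans (h i) (n∣m*n (s zero)) }

commonMultiple : {A : Set} → Finite A → (s : A → ℕ) → (∀ a → NonZero (s a)) →
                 ∃ λ N → NonZero N × (∀ a → s a ∣ N)
commonMultiple (n , e) s s≢0 with finCommonMultiple n (s ∘ from e) (s≢0 ∘ from e)
... | N , N≢0 , h = N , N≢0 , λ a → subst (λ a' → s a' ∣ N) (from-to e a) (h (to e a))

Σ-restrict : {A B : Set} {P : A → Set} {Q : B → Set} (ψ : A ↔ B) →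
             (∀ a → Irrelevant (P a)) → (∀ b → Irrelevant (Q b)) →
             (∀ a → P a → Q (to ψ a)) → (∀ a → Q (to ψ a) → P a) → Σ A P ↔ Σ B Q
Σ-restrict {A} {B} {P} {Q} ψ irrP irrQ f g = mk↔ₛ′
  (λ (a , p) → to ψ a , f a p)
  (λ (b , q) → from ψ b , g (from ψ b) (subst Q (sym (to-from ψ b)) q))
  (λ (b , q) → Σ≡ irrQ (to-from ψ b))
  (λ (a , p) → Σ≡ irrP (from-to ψ a))
  where
  Σ≡ : {C : Set} {R : C → Set} → (∀ c → Irrelevant (R c)) →
       {c c' : C} {r : R c} {r' : R c'} → c ≡ c' → (c , r) ≡ (c' , r')
  Σ≡ irr refl = cong (_ ,_) (irr _ _ _)

-- The fibre of f over d, which plays the role of a multiplicity.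
Fibre : {I D : Set} → (I → D) → D → Set
Fibre {I} f d = Σ I λ i → f i ≡ d

Σ-fibre : {I D : Set} (f : I → D) → I ↔ Σ D (Fibre f)
Σ-fibre f = mk↔ₛ′ (λ i → f i , i , refl) (λ (_ , i , _) → i) (λ { (_ , _ , refl) → refl }) (λ _ → refl)

-- Bijections between the fibres glue to a bijection of the index sets. In this way equality of
-- marginals becomes a permutation.
fibres⇒matching : {I J D : Set} (f : I → D) (g : J → D) → (∀ d → Fibre f d ↔ Fibre g d) →
                  Matching (λ i j → f i ≡ g j)
fibres⇒matching f g e =
  (↔-sym (Σ-fibre g) ↔-∘ (ΣCong.cong (↔-id _) (λ {d} → e d) ↔-∘ Σ-fibre f)) ,
  λ i → sym (proj₂ (to (e (f i)) (i , refl)))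

finite-any? : {A : Set} {P : A → Set} → Finite A → (∀ a → Dec (P a)) → Dec (Σ A P)
finite-any? {P = P} (_ , e) P? =
  map′ (λ (i , p) → from e i , p) (λ (a , p) → to e a , subst P (sym (from-to e a)) p) (any? (P? ∘ from e))

-- Colour refinement

-- As long as some `x` is lost, the cardinality of `S j` drops strictly, so it bounds the length of
-- the search.
finStabilise : ∀ n (P : ℕ → Fin n → Set) → (∀ j x → Dec (P j x)) →
               (∀ j x → P (suc j) x → P j x) → ∃ λ J → ∀ x → P J x → P (suc J) x
finStabilise n P P? mono = search _ 0 (n<1+n _)
  where
  S : ℕ → Subset n
  S j = tabulate λ x → ⌊ P? j x ⌋
  ∈S⁺ : ∀ j {x} → P j x → x ∈ₛ S j
  ∈S⁺ j {x} p = lookup⇒[]= x (S j)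
    (trans (lookup∘tabulate _ x) (trans (isYes≗does (P? j x)) (dec-true (P? j x) p)))
  ∈S⁻ : ∀ j {x} → x ∈ₛ S j → P j x
  ∈S⁻ j {x} m = toWitness {a? = P? j x}
    (subst T (trans (sym ([]=⇒lookup m)) (lookup∘tabulate _ x)) tt)
  search : ∀ fuel j → ∣ S j ∣ < fuel → ∃ λ J → ∀ x → P J x → P (suc J) x
  search (suc fuel) j (s≤s ∣S∣≤) with all? (λ x → P? j x →-dec P? (suc j) x)
  ... | yes h = j , h
  ... | no ¬h with ¬∀⟶∃¬ n _ (λ x → P? j x →-dec P? (suc j) x) ¬h
  ...   | x , ¬hx with P? j x
  ...     | no ¬p = ⊥-elim (¬hx (⊥-elim ∘ ¬p))
  ...     | yes p = search fuel (suc j) (≤-trans (p⊂q⇒∣p∣<∣q∣ S⊂) ∣S∣≤)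
    where
    S⊂ : S (suc j) ⊂ S j
    S⊂ = (λ m → ∈S⁺ j (mono j _ (∈S⁻ (suc j) m))) ,
         x , ∈S⁺ j p , λ m → ¬hx (λ _ → ∈S⁻ (suc j) m)

stabilise : {X : Set} → Finite X → (P : ℕ → X → Set) → (∀ j x → Dec (P j x)) →
            (∀ j x → P (suc j) x → P j x) → ∃ λ J → ∀ x → P J x → P (suc J) x
stabilise (n , e) P P? mono
  with finStabilise n (λ j i → P j (from e i)) (λ j i → P? j _) (λ j i → mono j _)
... | J , h = J , λ x p → subst (P (suc J)) (from-to e x)
                (h (to e x) (subst (P J) (sym (from-to e x)) p))

module _ {σ : Sig} where

  δEq-sym : {B C : Structure σ} → ∀ j {v w} → δEq B C j v w → δEq C B j w v
  δEq-sym zero p = sym p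
  δEq-sym {B} {C} (suc j) {v} {w} (ψ , h) = ↔-sym ψ , λ e →
    sym (trans (proj₁ (h (from ψ e))) (cong (lab C w) (to-from ψ e))) ,
    δEq-sym j (subst (λ e' → δEq B C j _ (tgt C w e')) (to-from ψ e) (proj₂ (h (from ψ e))))

  δEq-trans : {B C D : Structure σ} → ∀ j {u v w} → δEq B C j u v → δEq C D j v w → δEq B D j u w
  δEq-trans zero p q = trans p q
  δEq-trans (suc j) (ψ , h) (χ , g) = χ ↔-∘ ψ , λ e →
    trans (proj₁ (h e)) (proj₁ (g (to ψ e))) ,
    δEq-trans j (proj₂ (h e)) (proj₂ (g (to ψ e)))

  module _ (B : Structure σ) where
    occ⁺ : ∀ {n} {b : Vec (U B) n} {u} i → lookup b i ≡ u → T (occ B u b)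
    occ⁺ i p = fromWitness (i , p)

    occ⁻ : ∀ {n} {b : Vec (U B) n} {u} → T (occ B u b) → ∃ λ i → lookup b i ≡ u
    occ⁻ = toWitness

  module _ (finSym : Finite (Sym σ)) (B : Structure σ) (finU : Finite (U B)) where
    finite-Con : Finite (Con B)
    finite-Con = finite-Σ finSym λ R → finite-Σ (finite-Vec finU _) λ b → finite-T _

    finite-Vtx : Finite (Vtx B)
    finite-Vtx = finite-⊎ finU finite-Con

    finite-Nb : ∀ v → Finite (Nb B v)
    finite-Nb (inj₁ u) = finite-Σ finite-Con λ _ → finite-T _
    finite-Nb (inj₂ c) = finite-Σ finU λ _ → finite-T _

  finite-Label : Finite (Sym σ) → Finite (Label σ)
  finite-Label finSym = finite-Σ finSym λ R → finite-Vec finite-Bool _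

  δEq? : Finite (Sym σ) → (B C : Structure σ) → Finite (U B) → Finite (U C) →
         ∀ j v w → Dec (δEq B C j v w)
  δEq? finSym B C fB fC zero v w = δ₀ B v Bool.≟ δ₀ C w
  δEq? finSym B C fB fC (suc j) v w =
    matching? {P = λ e e' → lab B v e ≡ lab C w e' × δEq B C j (tgt B v e) (tgt C w e')}
      (finite-Nb finSym B fB v) (finite-Nb finSym C fC w) λ e e' →
      finite⇒dec≡ (finite-Label finSym) _ _ ×-dec δEq? finSym B C fB fC j _ _

  -- The label says that the edge ends at position i of an R-constraint.
  At : (R : Sym σ) → Fin (ar σ R) → Label σ → Set
  At R i L = Σ (Subset (ar σ R)) λ S → L ≡ (R , S) × lookup S i ≡ true

  At-irrelevant : ∀ R i L → Irrelevant (At R i L)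
  At-irrelevant R i .(R , S) (S , refl , p) (.S , refl , q) = cong (λ r → S , refl , r) (uip p q)

  module _ (B : Structure σ) where
    edge-At⁺ : ∀ {R b t u} i → lookup b i ≡ u → At R i (edgeLabel B u (R , b , t))
    edge-At⁺ {b = b} {u = u} i p = _ , refl ,
      trans (lookup∘tabulate _ i) (trans (isYes≗does d) (dec-true d p))
      where d = _≟_ B (lookup b i) u

    edge-At⁻ : ∀ {R c u} i → At R i (edgeLabel B u c) →
               Σ (Vec (U B) (ar σ R)) λ b → Σ (T (rel B R b)) λ t → c ≡ (R , b , t) × lookup b i ≡ u
    edge-At⁻ {c = _ , b , t} {u} i (_ , refl , p) =
      b , t , refl , toWitness {a? = _≟_ B (lookup b i) u} (subst T (trans (sym p) (lookup∘tabulate _ i)) tt)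

-- An equitable partition of the disjoint union of the two factor graphs, given by
-- the pairs of equivalent vertices from different sides.
record EquitableRelation {σ : Sig} (B C : Structure σ) : Set₁ where
  field
    _~_          : Vtx B → Vtx C → Set
    irrelevant   : ∀ {v w} → Irrelevant (v ~ w)
    dec          : ∀ v w → Dec (v ~ w)
    kind         : ∀ {v w} → v ~ w → δ₀ B v ≡ δ₀ C w
    total        : ∀ v → ∃ λ w → v ~ w
    difunctional : ∀ {v w v' w'} → v ~ w → v' ~ w → v' ~ w' → v ~ w'
    neighbours   : ∀ {v w} → v ~ w →
                   Matching λ e e' → lab B v e ≡ lab C w e' × tgt B v e ~ tgt C w e'

-- Bijections between neighbourhoods are far from unique, so `δEq` is not proof-irrelevant.
-- Replacing the relation by the truth of its decision makes classes countable as sets of vertices.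
squash : {σ : Sig} {B C : Structure σ} (_~_ : Vtx B → Vtx C → Set) (~? : ∀ v w → Dec (v ~ w)) →
         (∀ {v w} → v ~ w → δ₀ B v ≡ δ₀ C w) → (∀ v → ∃ λ w → v ~ w) →
         (∀ {v w v' w'} → v ~ w → v' ~ w → v' ~ w' → v ~ w') →
         (∀ {v w} → v ~ w → Matching λ e e' → lab B v e ≡ lab C w e' × tgt B v e ~ tgt C w e') →
         EquitableRelation B C
squash _~_ ~? kind total difun nbs = record
  { _~_ = λ v w → True (~? v w)
  ; irrelevant = T-irrelevant
  ; dec = λ v w → T? _
  ; kind = λ p → kind (toWitness p)
  ; total = λ v → proj₁ (total v) , fromWitness (proj₂ (total v))
  ; difunctional = λ p q r → fromWitness (difun (toWitness p) (toWitness q) (toWitness r))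
  ; neighbours = λ p → proj₁ (nbs (toWitness p)) ,
      λ e → proj₁ (proj₂ (nbs (toWitness p)) e) , fromWitness (proj₂ (proj₂ (nbs (toWitness p)) e)) }

module _ {σ : Sig} (finSym : Finite (Sym σ)) (B C : Structure σ)
         (fB : Finite (U B)) (fC : Finite (U C)) where
  private
    -- The kind is kept at every level: two vertices without neighbours agree at all positive
    -- levels, even if one is an element and the other a constraint. With the kind included, the
    -- relations decrease in `j`.
    E_at_ : ℕ → Vtx B × Vtx C → Set
    E j at (v , w) = δ₀ B v ≡ δ₀ C w × δEq B C j v w

    E? : ∀ j vw → Dec (E j at vw)
    E? j (v , w) = (δ₀ B v Bool.≟ δ₀ C w) ×-dec δEq? finSym B C fB fC j v w

    tgt-δ₀ : ∀ v w e e' → δ₀ B v ≡ δ₀ C w → δ₀ B (tgt B v e) ≡ δ₀ C (tgt C w e')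
    tgt-δ₀ (inj₁ _) (inj₁ _) e e' _ = refl
    tgt-δ₀ (inj₂ _) (inj₂ _) e e' _ = refl

    E-mono : ∀ j vw → E (suc j) at vw → E j at vw
    E-mono zero (v , w) (p , _) = p , p
    E-mono (suc j) (v , w) (p , ψ , h) = p , ψ , λ e → proj₁ (h e) ,
      proj₂ (E-mono j (tgt B v e , tgt C w (to ψ e)) (tgt-δ₀ v w e (to ψ e) p , proj₂ (h e)))

    module _ (J : ℕ) (stable : ∀ vw → E J at vw → E (suc J) at vw) (φ : Vtx B ↔ Vtx C)
             (φ-δ : ∀ v j → δEq B C j v (to φ v)) where

      -- Only vertices from different sides are compared, so this zigzag law stands in for symmetry
      -- and transitivity.
      E-difunctional : ∀ v w v' w' → E J at (v , w) → E J at (v' , w) → E J at (v' , w') →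
                       E J at (v , w')
      E-difunctional v w v' w' (p₀ , p) (q₀ , q) (r₀ , r) =
        trans p₀ (trans (sym q₀) r₀) ,
        δEq-trans {B = B} {C} {C} J {v} {w} {w'} p
          (δEq-trans {B = C} {B} {C} J {w} {v'} {w'} (δEq-sym {B = B} {C} J {v'} {w} q) r)

      -- Stability lifts the pair to level `suc J`, whose bijection matches neighbours at level `J`;
      -- the relation at level `J` is thus closed under passing to neighbours.
      E-neighbours : ∀ v w → E J at (v , w) →
                     Matching λ e e' → lab B v e ≡ lab C w e' × E J at (tgt B v e , tgt C w e')
      E-neighbours v w p =
        let p₀ , ψ , h = stable (v , w) p in
        ψ , λ e → proj₁ (h e) , tgt-δ₀ v w e (to ψ e) p₀ , proj₂ (h e)

      equitable : EquitableRelation B C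
      equitable = squash (λ v w → E J at (v , w)) (λ v w → E? J (v , w)) proj₁
        (λ v → to φ v , φ-δ v 0 , φ-δ v J)
        (λ {v} {w} {v'} {w'} → E-difunctional v w v' w')
        (λ {v} {w} → E-neighbours v w)

  ≡₁⇒equitable : B ≡₁ C → EquitableRelation B C
  ≡₁⇒equitable (φ , φ-δ) = equitable (proj₁ stable) (proj₂ stable) φ φ-δ
    where
    stable : ∃ λ J → ∀ vw → E J at vw → E (suc J) at vw
    stable = stabilise (finite-× (finite-Vtx finSym B fB) (finite-Vtx finSym C fC)) E_at_ E? E-mono

-- A random homomorphism whose law is uniform on a finite index set: constraints hold
-- for each index once their entries are re-indexed by the permutations τ, so that only
-- the marginals of the constraints agree with the laws P.
record BagHom {σ : Sig} (B C : Structure σ) : Set₁ where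
  field
    I      : Set
    finite : Finite I
    point  : I
    P      : U B → I → U C
    τ      : ∀ R b → T (rel B R b) → Fin (ar σ R) → I ↔ I
    pres   : ∀ R b t s → T (rel C R (tabulate λ i → P (lookup b i) (to (τ R b t i) s)))

-- Composition of random homomorphisms

module _ {σ : Sig} where

  bagHom-id : {B : Structure σ} → BagHom B B
  bagHom-id {B} = record
    { I = ⊤ ; finite = finite-T true ; point = tt
    ; P = λ u _ → u ; τ = λ _ _ _ _ → ↔-id ⊤
    ; pres = λ R b t _ → subst (T ∘ rel B R) (sym (tabulate∘lookup b)) t }

  bagHom-hom : {B C : Structure σ} → B ⟶ C → BagHom B C
  bagHom-hom {B} {C} (f , h) = record
    { I = ⊤ ; finite = finite-T true ; point = tt
    ; P = λ u _ → f u ; τ = λ _ _ _ _ → ↔-id ⊤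
    ; pres = λ R b t _ → subst (T ∘ rel C R)
        (sym (trans (tabulate-∘ f (lookup b)) (cong (map f) (tabulate∘lookup b)))) (h R b t) }

  -- The constraint of `C` that is reached depends on the first index `s`, and so does the
  -- permutation applied to the second index. Such a skew product is still a permutation of the
  -- pairs.
  bagHom-∘ : {B C D : Structure σ} → BagHom B C → BagHom C D → BagHom B D
  bagHom-∘ {D = D} G H = record
    { I = G.I × H.I
    ; finite = finite-× G.finite H.finite
    ; point = G.point , H.point
    ; P = λ u (s , s') → H.P (G.P u s) s'
    ; τ = λ R b t i → ΣCong.cong (G.τ R b t i) (λ {s} → H.τ R _ (G.pres R b t s) i)
    ; pres = λ R b t (s , s') → subst (T ∘ rel D R)
        (tabulate-cong λ i → cong (λ u → H.P u (to (H.τ R _ (G.pres R b t s) i) s')) (lookup∘tabulate _ i))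
        (H.pres R _ (G.pres R b t s) s') }
    where
    module G = BagHom G
    module H = BagHom H

-- Random homomorphisms from equal iterated degrees

×-cancelʳ-↔ : {X Y Z : Set} → Finite X → Finite Y → (fZ : Finite Z) → NonZero (card fZ) →
              (X × Z) ↔ (Y × Z) → X ↔ Y
×-cancelʳ-↔ fX@(x , e) fY@(y , f) (z , g) z≢0 ψ = card≡⇒↔ fX fY (*-cancelʳ-≡ x y z {{z≢0}}
  (finite-↔⇒card≡ (_ , ↔-sym *↔× ↔-∘ (e ×-↔ g)) (_ , ↔-sym *↔× ↔-∘ (f ×-↔ g)) ψ))

-- Through `p` the index set carries the uniform law of `D`, through `q` that of `K`. All fibres of
-- `f` have the size of `F`, so `f` carries the uniform law of `K` to that of `D`; cancelling `D`
-- matches the remaining coordinates `X × F` and `Y`.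
uniform-project : {I X Y K F D : Set} → Finite X → Finite Y → Finite F → (fD : Finite D) → NonZero (card fD) →
                  (p : I ↔ (Y × D)) (q : I ↔ (X × K)) (r : K ↔ (F × D)) (f : K → D) →
                  (∀ κ → proj₂ (to r κ) ≡ f κ) →
                  Matching λ s s' → proj₂ (to p s') ≡ f (proj₂ (to q s))
uniform-project {I} {X} {Y} {F = F} {D} fX fY fF fD D≢0 p q r f r-f =
  ↔-sym p ↔-∘ ((cancel ×-↔ ↔-id D) ↔-∘ q′) ,
  λ s → trans (cong proj₂ (to-from p (to (cancel ×-↔ ↔-id D) (to q′ s)))) (r-f (proj₂ (to q s)))
  where
  q′ : I ↔ ((X × F) × D)
  q′ = ↔-sym (×-assoc _ _ _ _) ↔-∘ ((↔-id X ×-↔ r) ↔-∘ q)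
  cancel : (X × F) ↔ Y
  cancel = ×-cancelʳ-↔ (finite-× fX fF) fY fD D≢0 (p ↔-∘ ↔-sym q′)

-- Send every vertex to a uniformly random vertex with the same iterated degree.  At the
-- stable level, projecting a class of constraints to one of its positions has fibres of
-- equal size, hence maps the uniform law to the uniform law.
module Equivalent {σ : Sig} (finSym : Finite (Sym σ)) (pos : ∀ R → Fin (ar σ R))
                  (B C : Structure σ) (fB : Finite (U B)) (fC : Finite (U C))
                  (B~C : EquitableRelation B C) where
  open EquitableRelation B~C

  finite-~ : ∀ v w → Finite (v ~ w)
  finite-~ v w = finite-prop (dec v w) irrelevant

  D : U B → Set
  D u = Σ (U C) λ d → inj₁ u ~ inj₁ d

  abstract
    finite-D : ∀ u → Finite (D u)
    finite-D u = finite-Σ fC λ _ → finite-~ _ _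

  D-≡ : ∀ {u} {d d' : D u} → proj₁ d ≡ proj₁ d' → d ≡ d'
  D-≡ {d = d , p} {.d , p'} refl = cong (d ,_) (irrelevant p p')

  D-point : ∀ u → D u
  D-point u with total (inj₁ u)
  ... | inj₁ d , p = d , p
  ... | inj₂ c , p with () ← kind p

  K : Con B → Set
  K c@(R , _) = Σ (Vec (U C) (ar σ R)) λ b → Σ (T (rel C R b)) λ t → inj₂ c ~ inj₂ (R , b , t)

  abstract
    finite-K : ∀ c → Finite (K c)
    finite-K c = finite-Σ (finite-Vec fC _) λ _ → finite-Σ (finite-T _) λ _ → finite-~ _ _

  -- The bijection of neighbourhoods preserves labels, and a label names the symbol and the
  -- positions of the edge. An equivalent constraint therefore has the same symbol, and equivalent
  -- entries position by position.
  ~-At : ∀ {R b t c'} → inj₂ (R , b , t) ~ inj₂ c' → ∀ i →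
         Σ (Vec (U C) (ar σ R)) λ b' → Σ (T (rel C R b')) λ t' →
           c' ≡ (R , b' , t') × inj₁ (lookup b i) ~ inj₁ (lookup b' i)
  ~-At {R} {b} {t} p i with neighbours p
  ... | ψ , h with h (lookup b i , occ⁺ B {b = b} i refl)
  ...   | lab≡ , q with edge-At⁻ C i (subst (At R i) lab≡ (edge-At⁺ B {t = t} i refl))
  ...     | b' , t' , c'≡ , b'ᵢ≡ = b' , t' , c'≡ , subst (λ d → _ ~ inj₁ d) (sym b'ᵢ≡) q

  K-point : ∀ c → K c
  K-point c@(R , _) with total (inj₂ c)
  ... | inj₁ _ , p with () ← kind p
  -- A position is required here: only the label of an edge reveals that `c'` carries the symbol
  -- `R`.
  ... | inj₂ c' , p with ~-At p (pos R)
  ...   | b' , t' , refl , _ = b' , t' , p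

  module _ (R : Sym σ) (b : Vec (U B) (ar σ R)) (t : T (rel B R b)) (i : Fin (ar σ R)) where
    private
      c : Con B
      c = R , b , t
      u = lookup b i

    project : K c → D u
    project (b' , t' , p) with ~-At p i
    ... | _ , _ , refl , q = lookup b' i , q

    project-lookup : ∀ κ → proj₁ (project κ) ≡ lookup (proj₁ κ) i
    project-lookup (b' , t' , p) with ~-At p i
    ... | _ , _ , refl , q = refl

    private
      Selected : (d : U C) → Nb C (inj₁ d) → Set
      Selected d ε = At R i (lab C (inj₁ d) ε) × inj₂ c ~ tgt C (inj₁ d) ε

      Selected-irrelevant : ∀ d ε → Irrelevant (Selected d ε)
      Selected-irrelevant d ε (a , p) (a' , p') =
        cong₂ _,_ (At-irrelevant R i _ a a') (irrelevant p p')

      Selected-≡ : ∀ {d} {c c' : Con C} {o o'} {s : Selected d (c , o)} {s' : Selected d (c' , o')} →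
                   c ≡ c' → ((c , o) , s) ≡ ((c' , o') , s')
      Selected-≡ {d} {c} {o = o} {o'} refl with T-irrelevant o o'
      ... | refl = cong ((c , o) ,_) (Selected-irrelevant d (c , o) _ _)

      -- Constraints of the class with entry `d` at position `i` are recast as edges at `d`, because
      -- equitability is stated for the edges at a vertex.
      fibre↔selected : ∀ d → Fibre project d ↔ Σ (Nb C (inj₁ (proj₁ d))) (Selected (proj₁ d))
      fibre↔selected d = mk↔ₛ′ f g f-g g-f
        where
        f : Fibre project d → Σ _ (Selected (proj₁ d))
        f (κ@(b' , t' , p) , q) = ((R , b' , t') , occ⁺ C {b = b'} i r) , edge-At⁺ C {t = t'} i r , p
          where r = trans (sym (project-lookup κ)) (cong proj₁ q)
        g : Σ _ (Selected (proj₁ d)) → Fibre project d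
        g ((c' , o) , a , p) with edge-At⁻ C {c = c'} i a
        ... | b' , t' , refl , q = (b' , t' , p) , D-≡ (trans (project-lookup _) q)
        f-g : ∀ s → f (g s) ≡ s
        f-g ((c' , o) , a , p) with edge-At⁻ C {c = c'} i a
        ... | b' , t' , refl , q = Selected-≡ {proj₁ d} refl
        g-f : ∀ s → g (f s) ≡ s
        g-f (κ@(b' , t' , p) , q)
          with edge-At⁻ C {c = R , b' , t'} i
                 (edge-At⁺ C {b = b'} {t = t'} i (trans (sym (project-lookup κ)) (cong proj₁ q)))
        ... | _ , _ , refl , q' = Fibre-≡ _ _
          where
          Fibre-≡ : ∀ {κ} (q q' : project κ ≡ d) → (κ , q) ≡ (κ , q')
          Fibre-≡ refl refl = refl

    -- Both `d` and `d'` are equivalent to `u`. Going from the edges at `d` back to those at `u` and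
    -- on to those at `d'` preserves labels, and by `difunctional` it preserves equivalence with
    -- `c`.
    fibres-equal : ∀ d d' → Fibre project d ↔ Fibre project d'
    fibres-equal d d' =
      ↔-sym (fibre↔selected d') ↔-∘ (Σ-restrict (χ ↔-∘ ↔-sym ψ)
        (Selected-irrelevant _) (Selected-irrelevant _)
        (λ ε (a , p) → subst (At R i) (lab≡ ε) a ,
          difunctional {w = tgt C (inj₁ (proj₁ d)) ε} p (~ψ ε) (~χ ε))
        (λ ε (a , p) → subst (At R i) (sym (lab≡ ε)) a ,
          difunctional {w = tgt C (inj₁ (proj₁ d')) (to χ (from ψ ε))} p (~χ ε) (~ψ ε))
      ↔-∘ fibre↔selected d)
      where
      ψ = proj₁ (neighbours (proj₂ d))
      χ = proj₁ (neighbours (proj₂ d'))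
      lab≡ : ∀ ε → lab C (inj₁ (proj₁ d)) ε ≡ lab C (inj₁ (proj₁ d')) (to χ (from ψ ε))
      lab≡ ε = trans (cong (lab C (inj₁ (proj₁ d))) (sym (to-from ψ ε)))
        (trans (sym (proj₁ (proj₂ (neighbours (proj₂ d)) (from ψ ε))))
          (proj₁ (proj₂ (neighbours (proj₂ d')) (from ψ ε))))
      ~ψ : ∀ ε → tgt B (inj₁ u) (from ψ ε) ~ tgt C (inj₁ (proj₁ d)) ε
      ~ψ ε = subst (λ ε' → tgt B (inj₁ u) (from ψ ε) ~ tgt C (inj₁ (proj₁ d)) ε') (to-from ψ ε)
               (proj₂ (proj₂ (neighbours (proj₂ d)) (from ψ ε)))
      ~χ : ∀ ε → tgt B (inj₁ u) (from ψ ε) ~ tgt C (inj₁ (proj₁ d')) (to χ (from ψ ε))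
      ~χ ε = proj₂ (proj₂ (neighbours (proj₂ d')) (from ψ ε))

    F : Set
    F = Fibre project (D-point u)

    abstract
      finite-F : Finite F
      finite-F = finite-Σ (finite-K c) λ κ → finite-≡ (finite-D u) (project κ) (D-point u)

    K↔F×D : K c ↔ (F × D u)
    K↔F×D = ×-comm (D u) F ↔-∘
      (ΣCong.cong (↔-id (D u)) (λ {d} → fibres-equal d (D-point u)) ↔-∘ Σ-fibre project)

    K↔F×D-project : ∀ κ → proj₂ (to K↔F×D κ) ≡ project κ
    K↔F×D-project κ = refl

  classSize : Vtx B → ℕ
  classSize (inj₁ u) = card (finite-D u)
  classSize (inj₂ c) = card (finite-K c)

  classSize≢0 : ∀ v → NonZero (classSize v)
  classSize≢0 (inj₁ u) = nonempty⇒card≢0 (finite-D u) (D-point u)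
  classSize≢0 (inj₂ c) = nonempty⇒card≢0 (finite-K c) (K-point c)

  abstract
    multiple : ∃ λ n → NonZero n × (∀ v → classSize v ∣ n)
    multiple = commonMultiple (finite-Vtx finSym B fB) classSize classSize≢0

  -- Being a common multiple of all class sizes, `N` lets one index set carry the uniform law of
  -- every class, each member occurring `copies` times.
  N = proj₁ multiple

  copies : Vtx B → ℕ
  copies v = quotient (proj₂ (proj₂ multiple) v)

  abstract
    Fin-split : {A : Set} (fA : Finite A) → ∀ q → N ≡ q * card fA → Fin N ↔ (Fin q × A)
    Fin-split (m , f) q N≡ = (↔-id (Fin q) ×-↔ ↔-sym f) ↔-∘
      (*↔× ↔-∘ subst (λ n → Fin N ↔ Fin n) N≡ (↔-id (Fin N)))

  copies-eq : ∀ v → N ≡ copies v * classSize v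
  copies-eq v = _∣_.equality (proj₂ (proj₂ multiple) v)

  split-D : ∀ u → Fin N ↔ (Fin (copies (inj₁ u)) × D u)
  split-D u = Fin-split (finite-D u) (copies (inj₁ u)) (copies-eq (inj₁ u))

  split-K : ∀ c → Fin N ↔ (Fin (copies (inj₂ c)) × K c)
  split-K c = Fin-split (finite-K c) (copies (inj₂ c)) (copies-eq (inj₂ c))

  law : U B → Fin N → U C
  law u s = proj₁ (proj₂ (to (split-D u) s))

  draw : ∀ c → Fin N → K c
  draw c s = proj₂ (to (split-K c) s)

  module _ (R : Sym σ) (b : Vec (U B) (ar σ R)) (t : T (rel B R b)) (i : Fin (ar σ R)) where
    private
      c : Con B
      c = R , b , t
      u = lookup b i

    uniform : Matching λ s s' → proj₂ (to (split-D u) s') ≡ project R b t i (draw c s)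
    uniform = uniform-project (finite-Fin _) (finite-Fin _)
      (finite-F R b t i) (finite-D u)
      (classSize≢0 (inj₁ u)) (split-D u) (split-K c) (K↔F×D R b t i)
      (project R b t i) (K↔F×D-project R b t i)

    reindex : Fin N ↔ Fin N
    reindex = proj₁ uniform

    reindex-project : ∀ s → law u (to reindex s) ≡ lookup (proj₁ (draw c s)) i
    reindex-project s = trans (cong proj₁ (proj₂ uniform s)) (project-lookup R b t i (draw c s))

  -- After re-indexing, the entries at index `s` are those of one and the same drawn constraint,
  -- which belongs to `C` by construction.
  pres : ∀ R b t s → T (rel C R (tabulate λ i → law (lookup b i) (to (reindex R b t i) s)))
  pres R b t s = subst (T ∘ rel C R)
    (trans (sym (tabulate∘lookup b'))
      (tabulate-cong λ i → sym (reindex-project R b t i s)))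
    (proj₁ (proj₂ κ))
    where
    κ = draw (R , b , t) s
    b' = proj₁ κ

  bagHom : BagHom B C
  bagHom = record
    { I = Fin N ; finite = finite-Fin N ; point = fin-point N (proj₁ (proj₂ multiple))
    ; P = law ; τ = reindex ; pres = pres }
    where
    fin-point : ∀ n → NonZero n → Fin n
    fin-point (suc n) _ = zero

chain⇒bagHom : ∀ {σ} → Finite (Sym σ) → (∀ R → Fin (ar σ R)) → {B C : Structure σ} →
               Finite (U B) → Chain B C → BagHom B C
chain⇒bagHom finSym pos fB [] = bagHom-id
chain⇒bagHom finSym pos fB ((fY , inj₁ h) ∷ ys) = bagHom-∘ (bagHom-hom h) (chain⇒bagHom finSym pos fY ys)
chain⇒bagHom finSym pos fB ((fY , inj₂ h) ∷ ys) =
  bagHom-∘ (Equivalent.bagHom finSym pos _ _ fB fY (≡₁⇒equitable finSym _ _ fB fY h))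
    (chain⇒bagHom finSym pos fY ys)

-- Lifts

⌊⌋-cong : {P Q : Set} (p? : Dec P) (q? : Dec Q) → (P → Q) → (Q → P) → ⌊ p? ⌋ ≡ ⌊ q? ⌋
⌊⌋-cong (yes _) (yes _) f g = refl
⌊⌋-cong (yes p) (no ¬q) f g = ⊥-elim (¬q (f p))
⌊⌋-cong (no ¬p) (yes q) f g = ⊥-elim (¬p (g q))
⌊⌋-cong (no _)  (no _)  f g = refl

-- Needed for the lift to preserve edge labels: if equal entries received different permutations, a
-- lifted constraint could have distinct entries where the base constraint repeats one.
Coherent : {σ : Sig} (B : Structure σ) {I : Set} →
           (∀ R b → T (rel B R b) → Fin (ar σ R) → I ↔ I) → Set
Coherent {σ} B τ = ∀ R b t i i' → lookup b i ≡ lookup b i' → ∀ s → to (τ R b t i) s ≡ to (τ R b t i') s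

-- A permutation voltage lift of the factor graph. Over each constraint `c` there is one constraint
-- for every index `s`, and its entry at position `i` lies on the sheet that the permutation of
-- position `i` assigns to `s`.
module Lift {σ : Sig} (finSym : Finite (Sym σ)) (pos : ∀ R → Fin (ar σ R))
            (B : Structure σ) (finU : Finite (U B)) {I : Set} (finI : Finite I)
            (τ : ∀ R b → T (rel B R b) → Fin (ar σ R) → I ↔ I) (coherent : Coherent B τ) where

  lift : ∀ R b → T (rel B R b) → I → Vec (U B × I) (ar σ R)
  lift R b t s = tabulate λ i → lookup b i , to (τ R b t i) s

  Lifted : ∀ R → Vec (U B × I) (ar σ R) → Set
  Lifted R v = Σ (Vec (U B) (ar σ R)) λ b → Σ (T (rel B R b)) λ t → Σ I λ s → v ≡ lift R b t s

  finite-U : Finite (U B × I)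
  finite-U = finite-× finU finI

  abstract
    lifted? : ∀ R v → Dec (Lifted R v)
    lifted? R v = finite-any? (finite-Vec finU _) λ b → finite-any? (finite-T _) λ t →
      finite-any? finI λ s → finite⇒dec≡ (finite-Vec finite-U _) _ _

  L : Structure σ
  L = record { U = U B × I ; _≟_ = finite⇒dec≡ finite-U ; rel = λ R v → ⌊ lifted? R v ⌋ }

  -- First components give back the base tuple. The index is then recovered at the single position
  -- `pos R`, since the permutation there is injective.
  lift-injective : ∀ R {b b' t t' s s'} → lift R b t s ≡ lift R b' t' s' →
                   _≡_ {A = Con B × I} ((R , b , t) , s) ((R , b' , t') , s')
  lift-injective R {b} {b'} {t} {t'} {s} {s'} p with b≡
    where
    pointwise : ∀ i → (lookup b i , to (τ R b t i) s) ≡ (lookup b' i , to (τ R b' t' i) s')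
    pointwise i = trans (sym (lookup∘tabulate _ i)) (trans (cong (λ v → lookup v i) p) (lookup∘tabulate _ i))
    b≡ : Σ (b ≡ b') λ _ → ∀ i → (lookup b i , to (τ R b t i) s) ≡ (lookup b' i , to (τ R b' t' i) s')
    b≡ = trans (sym (tabulate∘lookup b)) (trans (tabulate-cong (cong proj₁ ∘ pointwise)) (tabulate∘lookup b')) ,
      pointwise
  ... | refl , h with T-irrelevant t t'
  ...   | refl = cong (_ ,_) (to-injective (τ R b t (pos R)) (cong proj₂ (h (pos R))))

  Con-≡ : ∀ {R v v'} {r : T (rel L R v)} {r' : T (rel L R v')} → v ≡ v' →
          _≡_ {A = Con L} (R , v , r) (R , v' , r')
  Con-≡ {R} {v} {r = r} {r'} refl = cong (λ r → R , v , r) (T-irrelevant r r')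

  module _ (c : Con L) where
    private
      R = proj₁ c
      v = proj₁ (proj₂ c)
      w = toWitness {a? = lifted? R v} (proj₂ (proj₂ c))

    base : Con B
    base = R , proj₁ w , proj₁ (proj₂ w)

    index : I
    index = proj₁ (proj₂ (proj₂ w))

    permAt : Fin (ar σ R) → I ↔ I
    permAt = τ R (proj₁ w) (proj₁ (proj₂ w))

    lookup-lifted : ∀ i → lookup v i ≡ (lookup (proj₁ w) i , to (permAt i) index)
    lookup-lifted i = trans (cong (λ v → lookup v i) (proj₂ (proj₂ (proj₂ w)))) (lookup∘tabulate _ i)

    base-lookup : ∀ {x s} i → lookup v i ≡ (x , s) → lookup (proj₁ w) i ≡ x
    base-lookup i p = cong proj₁ (trans (sym (lookup-lifted i)) p)

    occ-base : ∀ {x s} → T (occ L (x , s) v) → T (occ B x (proj₁ w))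
    occ-base o with occ⁻ L {b = v} o
    ... | i , p = occ⁺ B {b = proj₁ w} i (base-lookup i p)

    -- Here coherence enters: all positions over `x` apply the same permutation to the index, so
    -- they all lie on the sheet `s`.
    occ-all : ∀ {x s} → T (occ L (x , s) v) → ∀ i → lookup (proj₁ w) i ≡ x → lookup v i ≡ (x , s)
    occ-all o i q with occ⁻ L {b = v} o
    ... | i' , p = trans (lookup-lifted i) (trans
      (cong₂ _,_ b≡ (coherent R _ _ i i' b≡ index)) (trans (sym (lookup-lifted i')) p))
      where b≡ = trans q (sym (base-lookup i' p))

    edgeLabel-base : ∀ {u} → T (occ L u v) → edgeLabel L u c ≡ edgeLabel B (proj₁ u) base
    edgeLabel-base o = cong (R ,_) (tabulate-cong λ i →
      ⌊⌋-cong (_≟_ L (lookup v i) _) (_≟_ B (lookup (proj₁ w) i) _) (base-lookup i) (occ-all o i))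

  lifted : Con B × I → Con L
  lifted ((R , b , t) , s) = R , lift R b t s , fromWitness (b , t , s , refl)

  Con↔ : Con L ↔ (Con B × I)
  Con↔ = mk↔ₛ′ (λ c → base c , index c) lifted
    (λ ((R , b , t) , s) → sym (lift-injective R
       (proj₂ (proj₂ (proj₂ (toWitness {a? = lifted? R (lift R b t s)} (fromWitness (b , t , s , refl))))))))
    (λ (R , v , r) → Con-≡ (sym (proj₂ (proj₂ (proj₂ (toWitness {a? = lifted? R v} r))))))

  project : Vtx L → Vtx B
  project (inj₁ (x , _)) = inj₁ x
  project (inj₂ c)       = inj₂ (base c)

  Σ-T-≡ : {A : Set} {f : A → Bool} {a a' : A} {p : T (f a)} {p' : T (f a')} → a ≡ a' → (a , p) ≡ (a' , p')
  Σ-T-≡ {p = p} {p'} refl = cong (_ ,_) (T-irrelevant p p')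

  -- The projection is a covering. At `(x , s)`, a base constraint containing `x` has a unique lift
  -- through that vertex, with index the preimage of `s` under the permutation at a position of `x`.
  -- At a constraint, the index determines the sheet of each entry.
  cover : ∀ v → Nb L v ↔ Nb B (project v)
  cover (inj₁ (x , s)) = mk↔ₛ′
    (λ (c , o) → base c , occ-base c o)
    back
    (λ (c , o) → Σ-T-≡ (cong proj₁ (to-from Con↔ (c , _))))
    (λ (c , o) → Σ-T-≡ (trans (cong (λ s' → lifted (base c , s')) (index-from c o)) (from-to Con↔ c)))
    where
    at : (c : Con B) → T (occ B x (FactorGraph.tuple B c)) → I ↔ I
    at (R , b , t) o = τ R b t (proj₁ (occ⁻ B {b = b} o))
    back : Nb B (inj₁ x) → Nb L (inj₁ (x , s))
    back (c@(R , b , t) , o) = lifted (c , from (at c o) s) ,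
      occ⁺ L {b = lift R b t _} i
        (trans (lookup∘tabulate _ i) (cong₂ _,_ (proj₂ (occ⁻ B {b = b} o)) (to-from (at c o) s)))
      where i = proj₁ (occ⁻ B {b = b} o)
    index-from : ∀ c o → from (at (base c) (occ-base c o)) s ≡ index c
    index-from c o = trans (cong (from p) (sym (cong proj₂
      (trans (sym (lookup-lifted c i)) (occ-all c o i
        (proj₂ (occ⁻ B {b = FactorGraph.tuple B (base c)} (occ-base c o))))))))
      (from-to p (index c))
      where
      p = at (base c) (occ-base c o)
      i = proj₁ (occ⁻ B {b = FactorGraph.tuple B (base c)} (occ-base c o))
  cover (inj₂ c@(R , v , r)) = mk↔ₛ′
    (λ ((x , s) , o) → x , occ-base c o)
    (λ (x , o) → let i , p = occ⁻ B {b = b} o in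
      (x , to (permAt c i) (index c)) ,
      occ⁺ L {b = v} i (trans (lookup-lifted c i) (cong (_, to (permAt c i) (index c)) p)))
    (λ _ → Σ-T-≡ refl)
    (λ ((x , s) , o) → let i , p = occ⁻ B {b = b} (occ-base c o) in
      Σ-T-≡ (cong (x ,_) (cong proj₂ (trans (sym (lookup-lifted c i)) (occ-all c o i p)))))
    where b = FactorGraph.tuple B (base c)

  -- Coverings are bijective on neighbourhoods and preserve labels, hence preserve iterated degrees
  -- at every level.
  δEq-project : ∀ j v → δEq L B j v (project v)
  δEq-project zero (inj₁ _) = refl
  δEq-project zero (inj₂ _) = refl
  δEq-project (suc j) v@(inj₁ u) = cover v , λ (c , o) → edgeLabel-base c o , δEq-project j (inj₂ c)
  δEq-project (suc j) v@(inj₂ c) = cover v , λ (u , o) → edgeLabel-base c o , δEq-project j (inj₁ u)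

module _ {σ : Sig} (finSym : Finite (Sym σ)) (pos : ∀ R → Fin (ar σ R))
         {B C : Structure σ} (finU : Finite (U B)) where

  -- Both lifts have `H.I` as set of sheets, so their vertices are matched fibrewise over `B`, and
  -- degrees are compared through `B`. The homomorphism condition out of the twisted lift is exactly
  -- the field `pres`.
  coherent⇒threeStep : (H : BagHom B C) → Coherent B (BagHom.τ H) → ThreeStep B C
  coherent⇒threeStep H coherent =
    L₁.L , L₂.L , L₁.finite-U , L₂.finite-U ,
    ((_, H.point) , λ R b t → fromWitness (b , t , H.point ,
      trans (cong (map _) (sym (tabulate∘lookup b))) (sym (tabulate-∘ _ (lookup b))))) ,
    (φ , λ v j → δEq-trans {B = L₁.L} {B} {L₂.L} j {v} {L₁.project v}
      (L₁.δEq-project j v)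
      (δEq-sym {B = L₂.L} {B} j {to φ v} {L₁.project v}
        (subst (δEq L₂.L B j (to φ v)) (project-φ v) (L₂.δEq-project j (to φ v))))) ,
    ((λ (x , s) → H.P x s) , hom)
    where
    module H = BagHom H
    module L₁ = Lift finSym pos B finU H.finite (λ _ _ _ _ → ↔-id _) (λ _ _ _ _ _ _ _ → refl)
    module L₂ = Lift finSym pos B finU H.finite H.τ coherent
    φ : Vtx L₁.L ↔ Vtx L₂.L
    φ = ↔-id _ ⊎-↔ (↔-sym L₂.Con↔ ↔-∘ L₁.Con↔)
    project-φ : ∀ v → L₂.project (to φ v) ≡ L₁.project v
    project-φ (inj₁ _) = refl
    project-φ (inj₂ c) = cong (inj₂ ∘ proj₁) (to-from L₂.Con↔ (to L₁.Con↔ c))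
    hom : ∀ R v → T (rel L₂.L R v) → T (rel C R (map (λ (x , s) → H.P x s) v))
    hom R v r with toWitness {a? = L₂.lifted? R v} r
    ... | b , t , s , refl = subst (T ∘ rel C R) (tabulate-∘ _ _) (H.pres R b t s)

-- Finiteness and relations of the star structures

module _ {m : ℕ} {ar : Fin m → ℕ} {k : ℕ} where

  position : (s : Sym* m ar k) → Fin (ar* s)
  position (T₁ _ _)   = zero
  position (T₂ _ _ _) = zero
  position (R₁ _ _)   = zero
  position (R₂ _ _ _) = zero

  finite-Subset : ∀ n → Finite (Subset n)
  finite-Subset = finite-Vec finite-Bool

  finite-Sym* : Finite (Sym* m ar k)
  finite-Sym* = finite-↔ (mk↔ₛ′
    (λ { (T₁ j S)    → inj₁ (inj₁ (j , S))
       ; (T₂ j j' i) → inj₁ (inj₂ (j , j' , i))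
       ; (R₁ R S)    → inj₂ (inj₁ (R , S))
       ; (R₂ R j i)  → inj₂ (inj₂ (R , j , i)) })
    (λ { (inj₁ (inj₁ (j , S)))      → T₁ j S
       ; (inj₁ (inj₂ (j , j' , i))) → T₂ j j' i
       ; (inj₂ (inj₁ (R , S)))      → R₁ R S
       ; (inj₂ (inj₂ (R , j , i)))  → R₂ R j i })
    (λ { (inj₁ (inj₁ _)) → refl ; (inj₁ (inj₂ _)) → refl
       ; (inj₂ (inj₁ _)) → refl ; (inj₂ (inj₂ _)) → refl })
    (λ { (T₁ _ _) → refl ; (T₂ _ _ _) → refl ; (R₁ _ _) → refl ; (R₂ _ _ _) → refl }))
    (finite-⊎
      (finite-⊎ (finite-Σ (finite-Fin k) λ _ → finite-Subset _)
                (finite-Σ (finite-Fin k) λ _ → finite-Σ (finite-Fin k) λ _ → finite-Vec (finite-Fin _) _))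
      (finite-⊎ (finite-Σ (finite-Fin m) λ _ → finite-Subset _)
                (finite-Σ (finite-Fin m) λ _ → finite-Σ (finite-Fin k) λ _ → finite-Vec (finite-Fin _) _)))

module StarProperties {m : ℕ} {ar : Fin m → ℕ} (𝔸 : FinStr m ar) (k : ℕ) where
  open FinStr 𝔸
  open Star 𝔸 k

  finite-U* : Finite U*
  finite-U* = finite-↔ (mk↔ₛ′
    (λ { (tup j a) → inj₁ (j , a) ; (con R a t) → inj₂ (R , a , t) })
    (λ { (inj₁ (j , a)) → tup j a ; (inj₂ (R , a , t)) → con R a t })
    (λ { (inj₁ _) → refl ; (inj₂ _) → refl })
    (λ { (tup _ _) → refl ; (con _ _ _) → refl }))
    (finite-⊎ (finite-Σ (finite-Fin k) λ _ → finite-Vec (finite-Fin size) _)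
              (finite-Σ (finite-Fin m) λ _ → finite-Σ (finite-Vec (finite-Fin size) _) λ _ → finite-T _))

  relT₁⁺ : ∀ j S a → EqOn S a → T (relT₁ j S (tup j a))
  relT₁⁺ j S a h with j F.≟ j
  ... | yes refl = fromWitness h
  ... | no j≢j = j≢j refl

  relT₁⁻ : ∀ j S u → T (relT₁ j S u) → Σ (Vec (Fin size) (len j)) λ a → u ≡ tup j a × EqOn S a
  relT₁⁻ j S (tup j' a) t with j F.≟ j'
  ... | yes refl = a , refl , toWitness t

  relT₂⁺ : ∀ j j' i a → T (relT₂ j j' i (tup j a) (tup j' (π i a)))
  relT₂⁺ j j' i a with j F.≟ j | j' F.≟ j'
  ... | yes refl | yes refl = fromWitness refl
  ... | yes refl | no j'≢j' = j'≢j' refl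
  ... | no j≢j | _ = j≢j refl

  relT₂⁻ : ∀ j j' i u v → T (relT₂ j j' i u v) →
           Σ (Vec (Fin size) (len j)) λ a → u ≡ tup j a × v ≡ tup j' (π i a)
  relT₂⁻ j j' i (tup j₁ a) (tup j₂ b) t with j F.≟ j₁ | j' F.≟ j₂
  ... | yes refl | yes refl = a , refl , cong (tup j') (toWitness t)

  relR₁⁺ : ∀ R S a t → EqOn S a → T (relR₁ R S (con R a t))
  relR₁⁺ R S a t h with R F.≟ R
  ... | yes refl = fromWitness h
  ... | no R≢R = R≢R refl

  relR₁⁻ : ∀ R S u → T (relR₁ R S u) →
           Σ (Vec (Fin size) (ar R)) λ a → Σ (T (relF R a)) λ t → u ≡ con R a t × EqOn S a
  relR₁⁻ R S (con R' a t') t with R F.≟ R'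
  ... | yes refl = a , t' , refl , toWitness t

  relR₂⁺ : ∀ R j i a t → T (relR₂ R j i (con R a t) (tup j (π i a)))
  relR₂⁺ R j i a t with R F.≟ R | j F.≟ j
  ... | yes refl | yes refl = fromWitness refl
  ... | yes refl | no j≢j = j≢j refl
  ... | no R≢R | _ = R≢R refl

  relR₂⁻ : ∀ R j i u v → T (relR₂ R j i u v) →
           Σ (Vec (Fin size) (ar R)) λ a → Σ (T (relF R a)) λ t → u ≡ con R a t × v ≡ tup j (π i a)
  relR₂⁻ R j i (con R' a t') (tup j' b) t with R F.≟ R' | j F.≟ j'
  ... | yes refl | yes refl = a , t' , refl , cong (tup j) (toWitness t)

  tup-injective : ∀ {j a b} → tup j a ≡ tup j b → a ≡ b
  tup-injective refl = refl

  con-injective : ∀ {R a b t t'} → con R a t ≡ con R b t' → a ≡ b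
  con-injective refl = refl

-- Partial maps

vec-ext : {A : Set} {n : ℕ} {v w : Vec A n} → (∀ i → lookup v i ≡ lookup w i) → v ≡ w
vec-ext {v = v} {w} h = trans (sym (tabulate∘lookup v)) (trans (tabulate-cong h) (tabulate∘lookup w))

subset-ext : {n : ℕ} {S S' : Subset n} → (∀ {i} → i ∈ₛ S → i ∈ₛ S') → (∀ {i} → i ∈ₛ S' → i ∈ₛ S) → S ≡ S'
subset-ext {S = S} {S'} f g = vec-ext λ i → cases i (lookup S i) (lookup S' i) refl refl
  where
  cases : ∀ i b b' → lookup S i ≡ b → lookup S' i ≡ b' → lookup S i ≡ lookup S' i
  cases i true  b' p q = trans p (sym ([]=⇒lookup (f (lookup⇒[]= i S p))))
  cases i false true  p q = trans ([]=⇒lookup (g (lookup⇒[]= i S' q))) (sym q)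
  cases i false false p q = trans p (sym q)

lookup-π : {A : Set} {j j' : ℕ} (ι : Vec (Fin j) j') (a : Vec A j) → ∀ i → lookup (π ι a) i ≡ lookup a (lookup ι i)
lookup-π ι a i = lookup-map i (lookup a) ι

-- The condition for sending each entry of `z` to the corresponding entry of `b` to be a
-- well-defined map.
Consistent : {A B : Set} {r : ℕ} → Vec A r → Vec B r → Set
Consistent z b = ∀ i i' → lookup z i ≡ lookup z i' → lookup b i ≡ lookup b i'

consistent-π : {A B : Set} {j j' : ℕ} (ι : Vec (Fin j) j') (z : Vec A j) (b : Vec B j) →
               Consistent z b → Consistent (π ι z) (π ι b)
consistent-π ι z b h i i' p = trans (lookup-π ι b i) (trans
  (h _ _ (trans (sym (lookup-π ι z i)) (trans p (lookup-π ι z i')))) (sym (lookup-π ι b i')))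

∣⁅x⁆∪p∣≤1+∣p∣ : ∀ {n} (x : Fin n) (p : Subset n) → ∣ ⁅ x ⁆ ∪ p ∣ ≤ suc ∣ p ∣
∣⁅x⁆∪p∣≤1+∣p∣ zero (b ∷ p) rewrite ∪-identityˡ p = s≤s (∣p∣≤∣x∷p∣ b p)
∣⁅x⁆∪p∣≤1+∣p∣ (suc x) (true ∷ p) = s≤s (∣⁅x⁆∪p∣≤1+∣p∣ x p)
∣⁅x⁆∪p∣≤1+∣p∣ (suc x) (false ∷ p) = ∣⁅x⁆∪p∣≤1+∣p∣ x p

elements : ∀ {n} (V : Subset n) → Vec (Fin n) ∣ V ∣
elements [] = []
elements (true ∷ V) = zero ∷ map suc (elements V)
elements (false ∷ V) = map suc (elements V)

elements⁺ : ∀ {n} (V : Subset n) {y} → y ∈ₛ V → ∃ λ i → lookup (elements V) i ≡ y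
elements⁺ (true ∷ V) {zero} _ = zero , refl
elements⁺ (true ∷ V) {suc y} (there h) with elements⁺ V h
... | i , p = suc i , trans (lookup-map i suc (elements V)) (cong suc p)
elements⁺ (false ∷ V) {suc y} (there h) with elements⁺ V h
... | i , p = i , trans (lookup-map i suc (elements V)) (cong suc p)

elements⁻ : ∀ {n} (V : Subset n) i → lookup (elements V) i ∈ₛ V
elements⁻ (true ∷ V) zero = here
elements⁻ (true ∷ V) (suc i) = subst (_∈ₛ (true ∷ V)) (sym (lookup-map i suc (elements V))) (there (elements⁻ V i))
elements⁻ (false ∷ V) i = subst (_∈ₛ (false ∷ V)) (sym (lookup-map i suc (elements V))) (there (elements⁻ V i))

module PartialMaps {m : ℕ} {ar : Fin m → ℕ} (𝕏 𝔸 : FinStr m ar) (k : ℕ) where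
  open SA 𝕏 𝔸 k public
  n = FinStr.size 𝕏
  a = FinStr.size 𝔸

  ∈-entries⁺ : ∀ {r} (z : Vec (Fin n) r) {y} i → lookup z i ≡ y → y ∈ₛ entries z
  ∈-entries⁺ z {y} i p = lookup⇒[]= y (entries z) (trans (lookup∘tabulate _ y)
    (trans (isYes≗does d) (dec-true d (i , p))))
    where d = any? (λ i → lookup z i F.≟ y)

  ∈-entries⁻ : ∀ {r} (z : Vec (Fin n) r) {y} → y ∈ₛ entries z → ∃ λ i → lookup z i ≡ y
  ∈-entries⁻ z {y} h = toWitness {a? = any? (λ i → lookup z i F.≟ y)}
    (subst T (trans (sym ([]=⇒lookup h)) (lookup∘tabulate _ y)) tt)

  ∈-dom⁺ : ∀ {g : PMap} {y x} → lookup g y ≡ just x → y ∈ₛ dom g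
  ∈-dom⁺ {g} {y} p = lookup⇒[]= y (dom g) (trans (lookup-map y is-just g) (cong is-just p))

  ∈-dom⁻ : ∀ {g : PMap} {y} → y ∈ₛ dom g → ∃ λ x → lookup g y ≡ just x
  ∈-dom⁻ {g} {y} h with lookup g y | trans (sym (lookup-map y is-just g)) ([]=⇒lookup h)
  ... | just x | _ = x , refl

  ∉-dom⁻ : ∀ {g : PMap} {y} → ¬ y ∈ₛ dom g → lookup g y ≡ nothing
  ∉-dom⁻ {g} {y} h with lookup g y in eq
  ... | just x  = ⊥-elim (h (∈-dom⁺ eq))
  ... | nothing = refl

  lookup-restrict : ∀ {U : Subset n} {g : PMap} {y} → y ∈ₛ U → lookup (restrict U g) y ≡ lookup g y
  lookup-restrict {U} {g} {y} h = trans (lookup-zipWith _ y U g)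
    (cong (λ b → if b then lookup g y else nothing) ([]=⇒lookup h))

  ∈-dom-restrict : ∀ {U : Subset n} {g : PMap} {y} → y ∈ₛ dom (restrict U g) → y ∈ₛ U × y ∈ₛ dom g
  ∈-dom-restrict {U} {g} {y} h with ∈-dom⁻ h
  ... | x , p with lookup U y in eq | trans (sym (lookup-zipWith _ y U g)) p
  ...   | true | q = lookup⇒[]= y U eq , ∈-dom⁺ q

  dom-restrict : ∀ {U : Subset n} {g : PMap} → U ⊆ dom g → dom (restrict U g) ≡ U
  dom-restrict U⊆ = subset-ext (proj₁ ∘ ∈-dom-restrict)
    (λ h → let x , p = ∈-dom⁻ (U⊆ h) in ∈-dom⁺ (trans (lookup-restrict h) p))

  PMap-ext : ∀ {g h : PMap} → dom g ≡ dom h → (∀ {y} → y ∈ₛ dom g → lookup g y ≡ lookup h y) → g ≡ h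
  PMap-ext {g} {h} dom≡ eq = vec-ext λ y → cases y (y ∈? dom g)
    where
    cases : ∀ y → Dec (y ∈ₛ dom g) → lookup g y ≡ lookup h y
    cases y (yes p) = eq p
    cases y (no ¬p) = trans (∉-dom⁻ ¬p) (sym (∉-dom⁻ (¬p ∘ subst (y ∈ₛ_) (sym dom≡))))

  restrict-dom : ∀ {g : PMap} → restrict (dom g) g ≡ g
  restrict-dom {g} = PMap-ext (dom-restrict {dom g} {g} (λ p → p))
    (λ h → lookup-restrict (proj₁ (∈-dom-restrict {dom g} {g} h)))

  valueAt : ∀ {r} {z : Vec (Fin n) r} {y} → Vec (Fin a) r → Dec (∃ λ i → lookup z i ≡ y) → Maybe (Fin a)
  valueAt b (yes (i , _)) = just (lookup b i)
  valueAt b (no _)        = nothing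

  -- At a repeated entry of `z` the value comes from whichever position `any?` finds; under
  -- `Consistent z b` the choice is immaterial.
  graph : ∀ {r} → Vec (Fin n) r → Vec (Fin a) r → PMap
  graph z b = tabulate λ y → valueAt {z = z} b (any? (λ i → lookup z i F.≟ y))

  lookup-graph : ∀ {r} (z : Vec (Fin n) r) (b : Vec (Fin a) r) → Consistent z b →
                 ∀ i → lookup (graph z b) (lookup z i) ≡ just (lookup b i)
  lookup-graph z b h i = trans (lookup∘tabulate _ (lookup z i))
    (defined (any? (λ i' → lookup z i' F.≟ lookup z i)))
    where
    defined : (d : Dec (∃ λ i' → lookup z i' ≡ lookup z i)) → valueAt {z = z} b d ≡ just (lookup b i)
    defined (yes (i' , p)) = cong just (h i' i p)
    defined (no ¬p)        = ⊥-elim (¬p (i , refl))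

  dom-graph : ∀ {r} (z : Vec (Fin n) r) (b : Vec (Fin a) r) → dom (graph z b) ≡ entries z
  dom-graph z b = vec-ext λ y → trans (lookup-map y is-just (graph z b))
    (trans (cong is-just (lookup∘tabulate _ y))
      (trans (defined (any? (λ i → lookup z i F.≟ y))) (sym (lookup∘tabulate _ y))))
    where
    defined : ∀ {y} (d : Dec (∃ λ i → lookup z i ≡ y)) → is-just (valueAt {z = z} b d) ≡ ⌊ d ⌋
    defined (yes _) = refl
    defined (no _)  = refl

  -- The dictionary between the two formalisms: projections of tuples, used by the star structures,
  -- are restrictions of partial maps, used by the relaxation.
  restrict-graph : ∀ {j j'} (ι : Vec (Fin j) j') (z : Vec (Fin n) j) (b : Vec (Fin a) j) → Consistent z b →
                   restrict (entries (π ι z)) (graph z b) ≡ graph (π ι z) (π ι b)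
  restrict-graph ι z b h = PMap-ext
    (trans (dom-restrict ⊆-dom) (sym (dom-graph (π ι z) (π ι b))))
    (λ {y} y∈ → agree (∈-entries⁻ (π ι z) (proj₁ (∈-dom-restrict {g = graph z b} y∈))))
    where
    ⊆-dom : entries (π ι z) ⊆ dom (graph z b)
    ⊆-dom y∈ with ∈-entries⁻ (π ι z) y∈
    ... | i , p = subst (_ ∈ₛ_) (sym (dom-graph z b)) (∈-entries⁺ z (lookup ι i) (trans (sym (lookup-π ι z i)) p))
    agree : ∀ {y} → (∃ λ i → lookup (π ι z) i ≡ y) →
            lookup (restrict (entries (π ι z)) (graph z b)) y ≡ lookup (graph (π ι z) (π ι b)) y
    agree (i , refl) = trans (lookup-restrict {g = graph z b} (∈-entries⁺ (π ι z) i refl))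
      (trans (cong (lookup (graph z b)) (lookup-π ι z i))
      (trans (lookup-graph z b h (lookup ι i))
      (trans (cong just (sym (lookup-π ι b i)))
             (sym (lookup-graph (π ι z) (π ι b) (consistent-π ι z b h) i)))))

  entries-π⊆ : ∀ {j j'} (ι : Vec (Fin j) j') (z : Vec (Fin n) j) → entries (π ι z) ⊆ entries z
  entries-π⊆ ι z y∈ with ∈-entries⁻ (π ι z) y∈
  ... | i , p = ∈-entries⁺ z (lookup ι i) (trans (sym (lookup-π ι z i)) p)

  values : ∀ {r} (z : Vec (Fin n) r) (g : PMap) → entries z ⊆ dom g →
           Σ (Vec (Fin a) r) λ b → ∀ i → lookup g (lookup z i) ≡ just (lookup b i)
  values z g h = tabulate (λ i → proj₁ (at i)) , λ i →
    trans (proj₂ (at i)) (cong just (sym (lookup∘tabulate (λ i → proj₁ (at i)) i)))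
    where
    at : ∀ i → ∃ λ x → lookup g (lookup z i) ≡ just x
    at i = ∈-dom⁻ (h (∈-entries⁺ z i refl))

  entries-nonempty : ∀ {r} (z : Vec (Fin n) (suc r)) → 1 ≤ ∣ entries z ∣
  entries-nonempty z = subst (_≤ ∣ entries z ∣) (∣⁅x⁆∣≡1 (lookup z zero))
    (p⊆q⇒∣p∣≤∣q∣ {p = ⁅ lookup z zero ⁆} λ y∈ → ∈-entries⁺ z zero (sym (x∈⁅y⁆⇒x≡y _ y∈)))

  ∣entries∣≤ : ∀ {r} (z : Vec (Fin n) r) → ∣ entries z ∣ ≤ r
  ∣entries∣≤ [] = ≤-reflexive (trans (cong ∣_∣ (subset-ext {S = entries []} {S' = ⊥}
    (λ h → ⊥-elim (Fin.¬Fin0 (proj₁ (∈-entries⁻ [] h)))) (λ h → ⊥-elim (∉⊥ h)))) (∣⊥∣≡0 n))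
  ∣entries∣≤ (x ∷ z) = ≤-trans (p⊆q⇒∣p∣≤∣q∣ sub) (≤-trans (∣⁅x⁆∪p∣≤1+∣p∣ x (entries z)) (s≤s (∣entries∣≤ z)))
    where
    sub : entries (x ∷ z) ⊆ (⁅ x ⁆ ∪ entries z)
    sub y∈ with ∈-entries⁻ (x ∷ z) y∈
    ... | zero , refl = x∈p∪q⁺ (inj₁ (x∈⁅x⁆ x))
    ... | suc i , p = x∈p∪q⁺ (inj₂ (∈-entries⁺ z i p))

  enumerate : ∀ V → 1 ≤ ∣ V ∣ → ∣ V ∣ ≤ k → Σ (Fin k) λ j → Σ (Vec (Fin n) (len j)) λ z → entries z ≡ V
  enumerate V 1≤ ≤k = go ∣ V ∣ 1≤ ≤k (elements V)
      (subset-ext (λ h → let i , p = ∈-entries⁻ (elements V) h in subst (_∈ₛ V) p (elements⁻ V i))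
                  (λ h → let i , p = elements⁺ V h in ∈-entries⁺ (elements V) i p))
    where
    go : ∀ r → 1 ≤ r → r ≤ k → (z : Vec (Fin n) r) → entries z ≡ V →
         Σ (Fin k) λ j → Σ (Vec (Fin n) (len j)) λ z → entries z ≡ V
    go (suc r) _ r<k z p = F.fromℕ< r<k ,
      subst (λ l → Σ (Vec (Fin n) (suc l)) λ z → entries z ≡ V) (sym (Fin.toℕ-fromℕ< r<k)) (z , p)

-- An integral form of an SA solution: the distributions p_V and p_{R(x)} are the laws
-- of G V and H R x for a uniform index in Fin N.
record RandomAssignment {m : ℕ} {ar : Fin m → ℕ} (𝕏 𝔸 : FinStr m ar) (k : ℕ) : Set where
  open PartialMaps 𝕏 𝔸 k
  field
    N       : ℕ
    N≢0     : NonZero N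
    G       : Subset n → Fin N → PMap
    H       : ∀ R x → T (FinStr.relF 𝕏 R x) → Fin N → PMap
    dom-G   : ∀ V → 1 ≤ ∣ V ∣ → ∣ V ∣ ≤ k → ∀ s → dom (G V s) ≡ V
    dom-H   : ∀ R x t s → dom (H R x t s) ≡ entries x
    marg-G  : ∀ U V → 1 ≤ ∣ U ∣ → U ⊆ V → ∣ V ∣ ≤ k →
              Matching λ s s' → restrict U (G V s) ≡ G U s'
    marg-H  : ∀ R x t U → 1 ≤ ∣ U ∣ → U ⊆ entries x → ∣ U ∣ ≤ k →
              Matching λ s s' → restrict U (H R x t s) ≡ G U s'
    support : ∀ R x t s (h : Vec (Fin a) (ar R)) → map just h ≡ map (lookup (H R x t s)) x →
              T (FinStr.relF 𝔸 R h)

-- From random homomorphisms to random assignments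

eqOn-pair : {A : Set} {r : ℕ} (z : Vec A r) {i i' : Fin r} → lookup z i ≡ lookup z i' → EqOn (⁅ i ⁆ ∪ ⁅ i' ⁆) z
eqOn-pair z {i} {i'} p j j' j∈ j'∈ = trans (at j∈) (sym (at j'∈))
  where
  at : ∀ {j} → j ∈ₛ (⁅ i ⁆ ∪ ⁅ i' ⁆) → lookup z j ≡ lookup z i
  at j∈ with x∈p∪q⁻ ⁅ i ⁆ ⁅ i' ⁆ j∈
  ... | inj₁ h = cong (lookup z) (x∈⁅y⁆⇒x≡y i h)
  ... | inj₂ h = trans (cong (lookup z) (x∈⁅y⁆⇒x≡y i' h)) (sym p)

eqOn-⊥ : {A : Set} {r : ℕ} (z : Vec A r) → EqOn ⊥ z
eqOn-⊥ z _ _ i∈ _ = ⊥-elim (∉⊥ i∈)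

-- Consistency of b with z is detected one pair of positions at a time.
consistent-eqOn : {A B : Set} {r : ℕ} (z : Vec A r) (b : Vec B r) →
                  (∀ S → EqOn S z → EqOn S b) → Consistent z b
consistent-eqOn z b h i i' p =
  h (⁅ i ⁆ ∪ ⁅ i' ⁆) (eqOn-pair z p) i i' (x∈p∪q⁺ (inj₁ (x∈⁅x⁆ i))) (x∈p∪q⁺ (inj₂ (x∈⁅x⁆ i')))

module FromBagHom {m : ℕ} {ar : Fin m → ℕ} (𝕏 𝔸 : FinStr m ar) (k : ℕ)
                  (hom : BagHom (𝕏 *^ k) (𝔸 *^ k)) where
  open PartialMaps 𝕏 𝔸 k
  open BagHom hom
  module X = StarProperties 𝕏 k
  module A = StarProperties 𝔸 k
  open Star 𝕏 k using (tup; con)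
  open Star 𝔸 k using () renaming (tup to tupA; con to conA)

  -- A unary constraint is satisfied only after re-indexing by `ρ`; since `ρ` is onto, evaluating at
  -- the preimage of `s` gives it at every index.
  tuple-eqOn : ∀ j z s S → EqOn S z → Σ (Vec (Fin a) (len j)) λ b → P (tup j z) s ≡ tupA j b × EqOn S b
  tuple-eqOn j z s S h = A.relT₁⁻ j S _
    (subst (λ s → T (Star.relT₁ 𝔸 k j S (P (tup j z) s))) (to-from ρ s)
      (pres (T₁ j S) (tup j z ∷ []) (X.relT₁⁺ j S z h) (from ρ s)))
    where ρ = τ (T₁ j S) (tup j z ∷ []) (X.relT₁⁺ j S z h) zero

  -- With `S` empty the relation asks no equalities and says only that the value is a tuple of the
  -- right length. Nonempty `S` enters later, for consistency.
  tuple : ∀ j (z : Vec (Fin n) (len j)) → I → Vec (Fin a) (len j)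
  tuple j z s = proj₁ (tuple-eqOn j z s ⊥ (eqOn-⊥ z))

  tuple-P : ∀ j z s → P (tup j z) s ≡ tupA j (tuple j z s)
  tuple-P j z s = proj₁ (proj₂ (tuple-eqOn j z s ⊥ (eqOn-⊥ z)))

  tuple-consistent : ∀ j z s → Consistent z (tuple j z s)
  tuple-consistent j z s = consistent-eqOn z (tuple j z s) λ S h → let b , p , q = tuple-eqOn j z s S h in
    subst (EqOn S) (A.tup-injective (trans (sym p) (tuple-P j z s))) q

  con-eqOn : ∀ R x t s S → EqOn S x →
             Σ (Vec (Fin a) (ar R)) λ b → Σ (T (FinStr.relF 𝔸 R b)) λ t' → P (con R x t) s ≡ conA R b t' × EqOn S b
  con-eqOn R x t s S h = A.relR₁⁻ R S _
    (subst (λ s → T (Star.relR₁ 𝔸 k R S (P (con R x t) s))) (to-from ρ s)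
      (pres (R₁ R S) (con R x t ∷ []) (X.relR₁⁺ R S x t h) (from ρ s)))
    where ρ = τ (R₁ R S) (con R x t ∷ []) (X.relR₁⁺ R S x t h) zero

  constraint : ∀ R x → T (FinStr.relF 𝕏 R x) → I → Vec (Fin a) (ar R)
  constraint R x t s = proj₁ (con-eqOn R x t s ⊥ (eqOn-⊥ x))

  constraint-rel : ∀ R x t s → T (FinStr.relF 𝔸 R (constraint R x t s))
  constraint-rel R x t s = proj₁ (proj₂ (con-eqOn R x t s ⊥ (eqOn-⊥ x)))

  constraint-P : ∀ R x t s → P (con R x t) s ≡ conA R (constraint R x t s) (constraint-rel R x t s)
  constraint-P R x t s = proj₁ (proj₂ (proj₂ (con-eqOn R x t s ⊥ (eqOn-⊥ x))))

  constraint-consistent : ∀ R x t s → Consistent x (constraint R x t s)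
  constraint-consistent R x t s = consistent-eqOn x (constraint R x t s) λ S h →
    let b , _ , p , q = con-eqOn R x t s S h in
    subst (EqOn S) (A.con-injective (trans (sym p) (constraint-P R x t s))) q

  -- The constraint relates the value of its first entry at `ρ₀ s` to that of its second at `ρ₁ s`,
  -- so the inverse of `ρ₀` followed by `ρ₁` matches the two laws.
  tuple-π : ∀ j j' ι z → Matching λ s s' → tuple j' (π ι z) s' ≡ π ι (tuple j z s)
  tuple-π j j' ι z = ρ₁ ↔-∘ ↔-sym ρ₀ , λ s →
    let b , p , q = A.relT₂⁻ j j' ι _ _ (pres (T₂ j j' ι) (tup j z ∷ tup j' (π ι z) ∷ []) t (from ρ₀ s))
        b≡ = A.tup-injective (trans (sym (tuple-P j z s)) (trans (cong (P (tup j z)) (sym (to-from ρ₀ s))) p))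
    in trans (A.tup-injective (trans (sym (tuple-P j' (π ι z) _)) q)) (cong (π ι) (sym b≡))
    where
    t = X.relT₂⁺ j j' ι z
    ρ₀ = τ (T₂ j j' ι) (tup j z ∷ tup j' (π ι z) ∷ []) t zero
    ρ₁ = τ (T₂ j j' ι) (tup j z ∷ tup j' (π ι z) ∷ []) t (suc zero)

  constraint-π : ∀ R x t j ι → Matching λ s s' → tuple j (π ι x) s' ≡ π ι (constraint R x t s)
  constraint-π R x t j ι = ρ₁ ↔-∘ ↔-sym ρ₀ , λ s →
    let b , _ , p , q = A.relR₂⁻ R j ι _ _ (pres (R₂ R j ι) (con R x t ∷ tup j (π ι x) ∷ []) t' (from ρ₀ s))
        b≡ = A.con-injective (trans (sym (constraint-P R x t s)) (trans (cong (P (con R x t)) (sym (to-from ρ₀ s))) p))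
    in trans (A.tup-injective (trans (sym (tuple-P j (π ι x) _)) q)) (cong (π ι) (sym b≡))
    where
    t' = X.relR₂⁺ R j ι x t
    ρ₀ = τ (R₂ R j ι) (con R x t ∷ tup j (π ι x) ∷ []) t' zero
    ρ₁ = τ (R₂ R j ι) (con R x t ∷ tup j (π ι x) ∷ []) t' (suc zero)

  factor : ∀ {r r'} (z : Vec (Fin n) r) (z' : Vec (Fin n) r') → entries z' ⊆ entries z → ∃ λ ι → z' ≡ π ι z
  factor z z' h = tabulate (λ i → proj₁ (at i)) , vec-ext λ i → sym
    (trans (lookup-π (tabulate (λ i → proj₁ (at i))) z i)
      (trans (cong (lookup z) (lookup∘tabulate _ i)) (proj₂ (at i))))
    where
    at : ∀ i → ∃ λ i' → lookup z i' ≡ lookup z' i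
    at i = ∈-entries⁻ z (h (∈-entries⁺ z' i refl))

  tuple-marginal : ∀ j z j' z' → entries z' ⊆ entries z →
                   Matching λ s s' → restrict (entries z') (graph z (tuple j z s)) ≡ graph z' (tuple j' z' s')
  tuple-marginal j z j' z' z'⊆z with factor z z' z'⊆z
  ... | ι , refl = proj₁ (tuple-π j j' ι z) , λ s →
    trans (restrict-graph ι z (tuple j z s) (tuple-consistent j z s))
      (cong (graph (π ι z)) (sym (proj₂ (tuple-π j j' ι z) s)))

  constraint-marginal : ∀ R x t j z → entries z ⊆ entries x →
                        Matching λ s s' → restrict (entries z) (graph x (constraint R x t s)) ≡ graph z (tuple j z s')
  constraint-marginal R x t j z z⊆x with factor x z z⊆x
  ... | ι , refl = proj₁ (constraint-π R x t j ι) , λ s →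
    trans (restrict-graph ι x (constraint R x t s) (constraint-consistent R x t s))
      (cong (graph (π ι x)) (sym (proj₂ (constraint-π R x t j ι) s)))

  constraint-support : ∀ R x t s (h : Vec (Fin a) (ar R)) →
                       map just h ≡ map (lookup (graph x (constraint R x t s))) x → T (FinStr.relF 𝔸 R h)
  constraint-support R x t s h p = subst (T ∘ FinStr.relF 𝔸 R) (vec-ext λ i → just-injective (begin
    just (lookup b i)                  ≡⟨ lookup-graph x b (constraint-consistent R x t s) i ⟨
    lookup g (lookup x i)              ≡⟨ lookup-map i (lookup g) x ⟨
    lookup (map (lookup g) x) i        ≡⟨ cong (λ v → lookup v i) p ⟨
    lookup (map just h) i              ≡⟨ lookup-map i just h ⟩
    just (lookup h i)                  ∎)) (constraint-rel R x t s)
    where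
    open ≡-Reasoning
    b = constraint R x t s
    g = graph x b

  -- Laws are indexed by all subsets; sizes outside the range from 1 to `k`, for which none is
  -- prescribed, get the empty partial map.
  sampleAt : ∀ V → Dec (1 ≤ ∣ V ∣) → Dec (∣ V ∣ ≤ k) → I → PMap
  sampleAt V (yes p) (yes q) s = let j , z , _ = enumerate V p q in graph z (tuple j z s)
  sampleAt V (yes p) (no _)  s = replicate n nothing
  sampleAt V (no _)  _       s = replicate n nothing

  sample : Subset n → I → PMap
  sample V = sampleAt V (1 ≤? ∣ V ∣) (∣ V ∣ ≤? k)

  sample-graph : ∀ V → 1 ≤ ∣ V ∣ → ∣ V ∣ ≤ k →
                 Σ (Fin k) λ j → Σ (Vec (Fin n) (len j)) λ z →
                   entries z ≡ V × (∀ s → sample V s ≡ graph z (tuple j z s))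
  sample-graph V p q with 1 ≤? ∣ V ∣ | ∣ V ∣ ≤? k
  ... | yes p' | yes q' = let j , z , r = enumerate V p' q' in j , z , r , λ _ → refl
  ... | yes p' | no ¬q = ⊥-elim (¬q q)
  ... | no ¬p | _ = ⊥-elim (¬p p)

  conjugate : ∀ {N} (e : I ↔ Fin N) (Q : I → I → Set) → Matching Q → Matching λ s s' → Q (from e s) (from e s')
  conjugate e Q (ψ , h) = e ↔-∘ (ψ ↔-∘ ↔-sym e) ,
    λ s → subst (Q (from e s)) (sym (from-to e _)) (h (from e s))

  dom-sample : ∀ V → 1 ≤ ∣ V ∣ → ∣ V ∣ ≤ k → ∀ s → dom (sample V s) ≡ V
  dom-sample V p q s with sample-graph V p q
  ... | j , z , refl , r = trans (cong dom (r s)) (dom-graph z (tuple j z s))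

  sample-marginal : ∀ U V → 1 ≤ ∣ U ∣ → U ⊆ V → ∣ V ∣ ≤ k →
                    Matching λ s s' → restrict U (sample V s) ≡ sample U s'
  sample-marginal U V p U⊆V q
    with sample-graph U p (≤-trans (p⊆q⇒∣p∣≤∣q∣ U⊆V) q) | sample-graph V (≤-trans p (p⊆q⇒∣p∣≤∣q∣ U⊆V)) q
  ... | j' , z' , refl , r' | j , z , refl , r with tuple-marginal j z j' z' U⊆V
  ...   | ψ , h = ψ , λ s → trans (cong (restrict (entries z')) (r s)) (trans (h s) (sym (r' (to ψ s))))

  sample-constraint-marginal : ∀ R x t U → 1 ≤ ∣ U ∣ → U ⊆ entries x → ∣ U ∣ ≤ k →
    Matching λ s s' → restrict U (graph x (constraint R x t s)) ≡ sample U s'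
  sample-constraint-marginal R x t U p U⊆ q with sample-graph U p q
  ... | j , z , refl , r with constraint-marginal R x t j z U⊆
  ...   | ψ , h = ψ , λ s → trans (h s) (sym (r (to ψ s)))

  randomAssignment : RandomAssignment 𝕏 𝔸 k
  randomAssignment = record
    { N = card finite
    ; N≢0 = nonempty⇒card≢0 finite point
    ; G = λ V s → sample V (from e s)
    ; H = λ R x t s → graph x (constraint R x t (from e s))
    ; dom-G = λ V p q s → dom-sample V p q _
    ; dom-H = λ R x t s → dom-graph x _
    ; marg-G = λ U V p U⊆V q → conjugate e (λ s s' → restrict U (sample V s) ≡ sample U s')
        (sample-marginal U V p U⊆V q)
    ; marg-H = λ R x t U p U⊆ q → conjugate e (λ s s' → restrict U (graph x (constraint R x t s)) ≡ sample U s')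
        (sample-constraint-marginal R x t U p U⊆ q)
    ; support = λ R x t s → constraint-support R x t _ }
    where e = proj₂ finite

-- Counting

𝟙 : Bool → ℕ
𝟙 b = card (finite-T b)

-- Taken as the cardinality of a subtype, so that bijections of indices compare counts directly; it
-- still unfolds to a sum of values of `𝟙`.
count : ∀ {N} → (Fin N → Bool) → ℕ
count {N} p = card (finite-ΣFin N (T ∘ p) (finite-T ∘ p))

count-matching : ∀ {M N} {p : Fin M → Bool} {q : Fin N → Bool} → Matching (λ i j → p i ≡ q j) → count p ≡ count q
count-matching {p = p} {q} (ψ , h) = finite-↔⇒card≡
  (finite-ΣFin _ (T ∘ p) (finite-T ∘ p)) (finite-ΣFin _ (T ∘ q) (finite-T ∘ q))
  (Σ-restrict ψ (λ _ → T-irrelevant) (λ _ → T-irrelevant) (λ i → subst T (h i)) (λ i → subst T (sym (h i))))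

count-cong : ∀ {N} {p q : Fin N → Bool} → (∀ i → p i ≡ q i) → count p ≡ count q
count-cong {zero} h = refl
count-cong {suc N} h = cong₂ _+_ (cong 𝟙 (h zero)) (count-cong (h ∘ suc))

count-true : ∀ N → count {N} (const true) ≡ N
count-true zero = refl
count-true (suc N) = cong suc (count-true N)

𝟙≤1 : ∀ b → 𝟙 b ≤ 1
𝟙≤1 true = s≤s z≤n
𝟙≤1 false = z≤n

count≤ : ∀ {N} (p : Fin N → Bool) → count p ≤ N
count≤ {zero} p = z≤n
count≤ {suc N} p = ℕ.+-mono-≤ (𝟙≤1 (p zero)) (count≤ (p ∘ suc))

count-positive : ∀ {N} (p : Fin N → Bool) → count p ≢ 0 → ∃ λ i → T (p i)
count-positive {zero} p h = ⊥-elim (h refl)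
count-positive {suc N} p h with p zero in eq
... | true = zero , Equivalence.from T-≡ eq
... | false = let i , t = count-positive (p ∘ suc) h in suc i , t

module _ {D : Set} where

  -- This sum and the next copy the fold of `sumOver`, which is thereby `sumℚ` over `allPMaps` by
  -- definition.
  sumℕ : (D → Bool) → (D → ℕ) → List D → ℕ
  sumℕ c w = foldr (λ g acc → if c g then w g + acc else acc) 0

  sumℚ : (D → Bool) → (D → ℚ) → List D → ℚ
  sumℚ c w = foldr (λ g acc → if c g then w g ℚ.+ acc else acc) 0ℚ

  sumℕ-cong : ∀ {c w w'} gs → (∀ g → T (c g) → w g ≡ w' g) → sumℕ c w gs ≡ sumℕ c w' gs
  sumℕ-cong [] h = refl
  sumℕ-cong {c} (g ∷ gs) h with c g in eq
  ... | true = cong₂ _+_ (h g (Equivalence.from T-≡ eq)) (sumℕ-cong gs h)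
  ... | false = sumℕ-cong gs h

  sumℕ-0 : ∀ {c} gs → sumℕ c (const 0) gs ≡ 0
  sumℕ-0 [] = refl
  sumℕ-0 {c} (g ∷ gs) with c g
  ... | true = sumℕ-0 gs
  ... | false = sumℕ-0 gs

  sumℕ-+ : ∀ c w w' gs → sumℕ c (λ g → w g + w' g) gs ≡ sumℕ c w gs + sumℕ c w' gs
  sumℕ-+ c w w' [] = refl
  sumℕ-+ c w w' (g ∷ gs) with c g
  ... | true = trans (cong (w g + w' g +_) (sumℕ-+ c w w' gs)) (interchange (w g) (w' g) _ _)
  ... | false = sumℕ-+ c w w' gs

  occurrences : DecidableEquality D → List D → D → ℕ
  occurrences _≟_ xs x = sumℕ (const true) (λ y → 𝟙 ⌊ x ≟ y ⌋) xs

  -- The decision procedure is quantified because vectors, `Maybe` and `Fin` each bring their own,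
  -- and an induction over these types would otherwise have to relate them.
  Enumerates : List D → Set
  Enumerates xs = ∀ (_≟_ : DecidableEquality D) x → occurrences _≟_ xs x ≡ 1

  sumℕ-indicator : ∀ {c} (_≟_ : DecidableEquality D) gs x →
                   sumℕ c (λ g → 𝟙 ⌊ x ≟ g ⌋) gs ≡ (if c x then occurrences _≟_ gs x else 0)
  sumℕ-indicator {c} _≟_ [] x with c x
  ... | true = refl
  ... | false = refl
  sumℕ-indicator {c} _≟_ (g ∷ gs) x with x ≟ g | sumℕ-indicator {c} _≟_ gs x
  ... | no _ | ih with c g
  ...   | true = ih
  ...   | false = ih
  sumℕ-indicator {c} _≟_ (g ∷ gs) x | yes refl | ih with c x
  ...   | true = cong suc ih
  ...   | false = ih

  -- Double counting: every index `s` contributes at the one place in the list where `F s` stands.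
  sumℕ-count : ∀ c gs (_≟_ : DecidableEquality D) → Enumerates gs → ∀ {N} (F : Fin N → D) →
               sumℕ c (λ g → count (λ s → ⌊ F s ≟ g ⌋)) gs ≡ count (c ∘ F)
  sumℕ-count c gs _≟_ once {zero} F = sumℕ-0 gs
  sumℕ-count c gs _≟_ once {suc N} F = trans (sumℕ-+ c (λ g → 𝟙 ⌊ F zero ≟ g ⌋) _ gs)
    (cong₂ _+_ (trans (sumℕ-indicator {c} _≟_ gs (F zero)) indicator) (sumℕ-count c gs _≟_ once (F ∘ suc)))
    where
    indicator : (if c (F zero) then occurrences _≟_ gs (F zero) else 0) ≡ 𝟙 (c (F zero))
    indicator with c (F zero)
    ... | true = once _≟_ (F zero)
    ... | false = refl

  occurrences-++ : ∀ d xs ys x → occurrences d (xs ++ ys) x ≡ occurrences d xs x + occurrences d ys x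
  occurrences-++ d [] ys x = refl
  occurrences-++ d (y ∷ xs) ys x = trans (cong (_ +_) (occurrences-++ d xs ys x)) (sym (ℕ.+-assoc (𝟙 ⌊ d x y ⌋) _ _))

module _ {C D : Set} where

  occurrences-map : (d : DecidableEquality D) (d' : DecidableEquality C) {f : C → D} →
                    (∀ {x y} → f x ≡ f y → x ≡ y) → ∀ xs x → occurrences d (List.map f xs) (f x) ≡ occurrences d' xs x
  occurrences-map d d' inj [] x = refl
  occurrences-map d d' {f} inj (y ∷ xs) x with d (f x) (f y) | d' x y
  ... | yes p | yes q = cong suc (occurrences-map d d' inj xs x)
  ... | yes p | no ¬q = ⊥-elim (¬q (inj p))
  ... | no ¬p | yes q = ⊥-elim (¬p (cong f q))
  ... | no ¬p | no ¬q = occurrences-map d d' inj xs x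

  occurrences-∉map : (d : DecidableEquality D) {f : C → D} {x : D} → ∀ xs →
                     (∀ y → x ≢ f y) → occurrences d (List.map f xs) x ≡ 0
  occurrences-∉map d [] h = refl
  occurrences-∉map d {f} {x} (y ∷ xs) h with d x (f y)
  ... | yes p = ⊥-elim (h y p)
  ... | no _ = occurrences-∉map d xs h

allFin-enumerates : ∀ n → Enumerates (List.allFin n)
allFin-enumerates (suc n) d zero with d zero zero
... | yes _ = cong suc (trans (cong (λ xs → occurrences d xs zero) (sym (map-tabulate (λ i → i) suc)))
  (occurrences-∉map d (List.allFin n) λ _ ()))
... | no ¬p = ⊥-elim (¬p refl)
allFin-enumerates (suc n) d (suc i) with d (suc i) zero
... | no _ = trans (cong (λ xs → occurrences d xs (suc i)) (sym (map-tabulate (λ i → i) suc)))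
  (trans (occurrences-map d Fin._≟_ Fin.suc-injective (List.allFin n) i) (allFin-enumerates n Fin._≟_ i))

maybe-enumerates : ∀ {A : Set} (xs : List A) → DecidableEquality A → Enumerates xs →
                   Enumerates (nothing ∷ List.map just xs)
maybe-enumerates xs dA once d nothing with d nothing nothing
... | yes _ = cong suc (occurrences-∉map d xs λ _ ())
... | no ¬p = ⊥-elim (¬p refl)
maybe-enumerates xs dA once d (just x) with d (just x) nothing
... | no _ = trans (occurrences-map d dA just-injective xs x) (once dA x)

module Enumeration {m : ℕ} {ar : Fin m → ℕ} (𝕏 𝔸 : FinStr m ar) (k : ℕ) where
  open PartialMaps 𝕏 𝔸 k

  allVecs-enumerates : ∀ {A : Set} (xs : List A) → DecidableEquality A → Enumerates xs → ∀ r → Enumerates (allVecs xs r)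
  allVecs-enumerates xs dA once zero d [] with d [] []
  ... | yes _ = refl
  ... | no ¬p = ⊥-elim (¬p refl)
  allVecs-enumerates xs dA once (suc r) d (x ∷ v) = trans (prefixed xs) (once dA x)
    where
    prefixed : ∀ ys → occurrences d (concatMap (λ y → List.map (y ∷_) (allVecs xs r)) ys) (x ∷ v) ≡
                      occurrences dA ys x
    prefixed [] = refl
    prefixed (y ∷ ys) = trans (occurrences-++ d (List.map (y ∷_) (allVecs xs r)) _ (x ∷ v))
        (cong₂ _+_ first (prefixed ys))
      where
      first : occurrences d (List.map (y ∷_) (allVecs xs r)) (x ∷ v) ≡ 𝟙 ⌊ dA x y ⌋
      first with dA x y
      ... | yes refl = trans (occurrences-map d (≡-dec dA) ∷-injectiveʳ (allVecs xs r) v)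
                         (allVecs-enumerates xs dA once r (≡-dec dA) v)
      ... | no x≢y = occurrences-∉map d (allVecs xs r) (λ _ p → x≢y (∷-injectiveˡ p))

  allPMaps-enumerates : Enumerates allPMaps
  allPMaps-enumerates = allVecs-enumerates _ (Maybe-≡-dec F._≟_)
    (maybe-enumerates (List.allFin a) F._≟_ (allFin-enumerates a)) n

-- Clearing denominators

ι : ℕ → ℚ
ι zero    = 0ℚ
ι (suc n) = 1ℚ ℚ.+ ι n

ι-+ : ∀ m n → ι (m + n) ≡ ι m ℚ.+ ι n
ι-+ zero    n = sym (ℚ.+-identityˡ (ι n))
ι-+ (suc m) n = trans (cong (1ℚ ℚ.+_) (ι-+ m n)) (sym (ℚ.+-assoc 1ℚ (ι m) (ι n)))

ι-* : ∀ m n → ι (m ℕ.* n) ≡ ι m ℚ.* ι n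
ι-* zero    n = sym (ℚ.*-zeroˡ (ι n))
ι-* (suc m) n = begin
  ι (n + m ℕ.* n)                 ≡⟨ ι-+ n (m ℕ.* n) ⟩
  ι n ℚ.+ ι (m ℕ.* n)             ≡⟨ cong₂ ℚ._+_ (sym (ℚ.*-identityˡ (ι n))) (ι-* m n) ⟩
  1ℚ ℚ.* ι n ℚ.+ ι m ℚ.* ι n      ≡⟨ ℚ.*-distribʳ-+ (ι n) 1ℚ (ι m) ⟨
  (1ℚ ℚ.+ ι m) ℚ.* ι n            ∎
  where open ≡-Reasoning

0≤1 : 0ℚ ℚ.≤ 1ℚ
0≤1 = ℚ.nonNegative⁻¹ 1ℚ

0≤ι : ∀ n → 0ℚ ℚ.≤ ι n
0≤ι zero    = ℚ.≤-refl
0≤ι (suc n) = ℚ.+-mono-≤ 0≤1 (0≤ι n)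

ι-mono : ∀ {m n} → m ≤ n → ι m ℚ.≤ ι n
ι-mono {n = n} z≤n = 0≤ι n
ι-mono (s≤s h) = ℚ.+-mono-≤ (ℚ.≤-refl {1ℚ}) (ι-mono h)

0<ι : ∀ n → 0ℚ ℚ.< ι (suc n)
0<ι n = ℚ.+-mono-<-≤ (ℚ.positive⁻¹ 1ℚ) (0≤ι n)

ι-injective : ∀ {m n} → ι m ≡ ι n → m ≡ n
ι-injective {zero}  {zero}  p = refl
ι-injective {zero}  {suc n} p = ⊥-elim (ℚ.<⇒≢ (0<ι n) p)
ι-injective {suc m} {zero}  p = ⊥-elim (ℚ.<⇒≢ (0<ι m) (sym p))
ι-injective {suc m} {suc n} p = cong suc (ι-injective (∙-cancelˡ 1ℚ (ι m) (ι n) p))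

-- Multiplication by `ι N` can be cancelled, so equations and bounds between fractions with
-- denominator `N` reduce to natural numbers.
module Scaled (N : ℕ) (N≢0 : NonZero N) where
  ιN-positive : ℚ.Positive (ι N)
  ιN-positive = go N N≢0
    where
    go : ∀ N → NonZero N → ℚ.Positive (ι N)
    go (suc N) _ = ℚ.positive (0<ι N)

  instance
    _ = ιN-positive

  scale-cancel-≤ : ∀ {p q} → ι N ℚ.* p ℚ.≤ ι N ℚ.* q → p ℚ.≤ q
  scale-cancel-≤ = ℚ.*-cancelˡ-≤-pos (ι N)

  scale-cancel-≡ : ∀ {p q} → ι N ℚ.* p ≡ ι N ℚ.* q → p ≡ q
  scale-cancel-≡ h = ℚ.≤-antisym (scale-cancel-≤ (ℚ.≤-reflexive h)) (scale-cancel-≤ (ℚ.≤-reflexive (sym h)))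

  fraction : ℕ → ℚ
  fraction w = ι w ℚ.* ℚ.1/_ (ι N) {{ℚ.pos⇒nonZero (ι N)}}

  scale-fraction : ∀ w → ι N ℚ.* fraction w ≡ ι w
  scale-fraction w = begin
    ι N ℚ.* (ι w ℚ.* r)   ≡⟨ cong (ι N ℚ.*_) (ℚ.*-comm (ι w) r) ⟩
    ι N ℚ.* (r ℚ.* ι w)   ≡⟨ ℚ.*-assoc (ι N) r (ι w) ⟨
    (ι N ℚ.* r) ℚ.* ι w   ≡⟨ cong (ℚ._* ι w) (ℚ.*-inverseʳ (ι N) {{ℚ.pos⇒nonZero (ι N)}}) ⟩
    1ℚ ℚ.* ι w            ≡⟨ ℚ.*-identityˡ (ι w) ⟩
    ι w                   ∎
    where
    open ≡-Reasoning
    r = ℚ.1/_ (ι N) {{ℚ.pos⇒nonZero (ι N)}}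

  scale-0 : ι N ℚ.* 0ℚ ≡ ι 0
  scale-0 = ℚ.*-zeroʳ (ι N)

  scale-1 : ι N ℚ.* 1ℚ ≡ ι N
  scale-1 = ℚ.*-identityʳ (ι N)

  scaled-range : ∀ {p w} → ι N ℚ.* p ≡ ι w → w ≤ N → (0ℚ ℚ.≤ p) × (p ℚ.≤ 1ℚ)
  scaled-range {p} {w} h w≤N =
    scale-cancel-≤ (subst₂ ℚ._≤_ (sym scale-0) (sym h) (0≤ι w)) ,
    scale-cancel-≤ (subst₂ ℚ._≤_ (sym h) (sym scale-1) (ι-mono w≤N))

  scale-sum : ∀ {D : Set} (c : D → Bool) (f : D → ℚ) (w : D → ℕ) gs →
              (∀ g → T (c g) → ι N ℚ.* f g ≡ ι (w g)) → ι N ℚ.* sumℚ c f gs ≡ ι (sumℕ c w gs)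
  scale-sum c f w [] h = scale-0
  scale-sum c f w (g ∷ gs) h with c g in eq
  ... | true = trans (ℚ.*-distribˡ-+ (ι N) (f g) (sumℚ c f gs))
    (trans (cong₂ ℚ._+_ (h g (Equivalence.from T-≡ eq)) (scale-sum c f w gs h)) (sym (ι-+ (w g) _)))
  ... | false = scale-sum c f w gs h

-- From random assignments to Sherali-Adams solutions

module ToSA {m : ℕ} {ar : Fin m → ℕ} (𝕏 𝔸 : FinStr m ar) (k : ℕ) (ra : RandomAssignment 𝕏 𝔸 k) where
  open PartialMaps 𝕏 𝔸 k
  open Enumeration 𝕏 𝔸 k
  open RandomAssignment ra
  open Scaled N N≢0

  frequency : (Fin N → PMap) → PMap → ℕ
  frequency F g = count (λ s → F s =P g)

  p : PMap → ℚ
  p g = fraction (frequency (G (dom g)) g)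

  qAt : ∀ R x → Dec (T (FinStr.relF 𝕏 R x)) → PMap → ℚ
  qAt R x (yes t) g = fraction (frequency (H R x t) g)
  qAt R x (no _)  g = 0ℚ

  q : ∀ R → Vec (Fin n) (ar R) → PMap → ℚ
  q R x = qAt R x (T? (FinStr.relF 𝕏 R x))

  scale-p : ∀ {V} g → dom g ≡ V → ι N ℚ.* p g ≡ ι (frequency (G V) g)
  scale-p g refl = scale-fraction (frequency (G (dom g)) g)

  scale-q : ∀ R x t g → ι N ℚ.* q R x g ≡ ι (frequency (H R x t) g)
  scale-q R x t g with T? (FinStr.relF 𝕏 R x)
  ... | yes t' = trans (scale-fraction (frequency (H R x t') g))
                 (cong (λ t → ι (frequency (H R x t) g)) (T-irrelevant t' t))
  ... | no ¬t = ⊥-elim (¬t t)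

  sum-frequency : ∀ (c : PMap → Bool) (f : PMap → ℚ) (F : Fin N → PMap) →
                  (∀ g → T (c g) → ι N ℚ.* f g ≡ ι (frequency F g)) → ι N ℚ.* sumOver c f ≡ ι (count (c ∘ F))
  sum-frequency c f F h = trans (scale-sum c f (frequency F) allPMaps h)
    (cong ι (sumℕ-count c allPMaps (≡-dec (Maybe-≡-dec F._≟_)) allPMaps-enumerates F))

  =S⁺ : ∀ {S S'} → S ≡ S' → (S =S S') ≡ true
  =S⁺ {S} {S'} p = Equivalence.to T-≡ (fromWitness p)

  =S⁻ : ∀ {S S'} → T (S =S S') → S ≡ S'
  =S⁻ = toWitness

  -- Multiplied by `N`, both sides count indices, and the matching carries the indices where `F`
  -- restricts to `h` onto those where `G U` equals `h`.
  marginal : ∀ {U W : Subset n} (F : Fin N → PMap) (f : PMap → ℚ) → (∀ s → dom (F s) ≡ W) →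
             (∀ g → dom g ≡ W → ι N ℚ.* f g ≡ ι (frequency F g)) →
             (Matching λ s s' → restrict U (F s) ≡ G U s') → ∀ h → dom h ≡ U →
             p h ≡ sumOver (λ g → (dom g =S W) ∧ (restrict U g =P h)) f
  marginal {U} {W} F f dom-F scale-f match h dom-h = scale-cancel-≡ (begin
    ι N ℚ.* p h                    ≡⟨ scale-p h dom-h ⟩
    ι (count (λ s → G U s =P h))   ≡⟨ cong ι (count-matching {p = c ∘ F} {λ s → G U s =P h} matched) ⟨
    ι (count (c ∘ F))              ≡⟨ sum-frequency c f F (λ g t → scale-f g (=S⁻ (proj₁ (Equivalence.to T-∧ t)))) ⟨
    ι N ℚ.* sumOver c f            ∎)
    where
    open ≡-Reasoning
    c : PMap → Bool
    c g = (dom g =S W) ∧ (restrict U g =P h)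
    matched : Matching λ s s' → c (F s) ≡ (G U s' =P h)
    matched = proj₁ match , λ s → cong₂ _∧_ (=S⁺ (dom-F s)) (cong (_=P h) (proj₂ match s))

  solution : SAFeasible 𝕏 𝔸 k
  solution = record
    { p = p
    ; q = q
    ; p-range = λ g _ _ → scaled-range (scale-p g refl) (count≤ (λ s → G (dom g) s =P g))
    ; q-range = λ R x t g _ → scaled-range (scale-q R x t g) (count≤ (λ s → H R x t s =P g))
    ; sum-one = λ V 1≤ ≤k → scale-cancel-≡ (trans (sum-frequency (λ g → dom g =S V) p (G V) (λ g t → scale-p g (=S⁻ t)))
        (trans (cong ι (trans (count-cong (λ s → =S⁺ (dom-G V 1≤ ≤k s))) (count-true N))) (sym scale-1)))
    ; marg = λ U V 1≤ U⊆V ≤k →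
        marginal (G V) p (dom-G V (≤-trans 1≤ (p⊆q⇒∣p∣≤∣q∣ U⊆V)) ≤k) scale-p (marg-G U V 1≤ U⊆V ≤k)
    ; margC = λ R x t U 1≤ U⊆ ≤k →
        marginal (H R x t) (q R x) (dom-H R x t) (λ g _ → scale-q R x t g) (marg-H R x t U 1≤ U⊆ ≤k)
    ; support = λ R x t g _ h h≡ h∉ → scale-cancel-≡ (trans (scale-q R x t g)
        (trans (cong ι (never R x t g h h≡ h∉)) (sym scale-0))) }
    where
    -- A positive frequency would make `g` a value of `H R x t`, and `support` would then put `h`
    -- into the relation of 𝔸.
    never : ∀ R x t g (h : Vec (Fin a) (ar R)) → map just h ≡ map (lookup g) x → FinStr.relF 𝔸 R h ≡ false →
            frequency (H R x t) g ≡ 0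
    never R x t g h h≡ h∉ with frequency (H R x t) g in eq
    ... | zero = refl
    ... | suc _ with count-positive (λ s → H R x t s =P g) (λ z → ℕ.1+n≢0 (trans (sym eq) z))
    ...   | s , e = ⊥-elim (subst T h∉ (support R x t s h
      (subst (λ g → map just h ≡ map (lookup g) x) (sym (toWitness e)) h≡)))

-- From Sherali-Adams solutions to random assignments

toℚᵘ-ι : ∀ n → toℚᵘ (ι n) ≃ mkℚᵘ (ℤ.+ n) 0
toℚᵘ-ι zero = *≡* refl
toℚᵘ-ι (suc n) = ≃-trans (toℚᵘ-homo-+ 1ℚ (ι n)) (≃-trans (ℚᵘ.+-congʳ ℚᵘ.1ℚᵘ (toℚᵘ-ι n))
  (*≡* (cong (ℤ._* (ℤ.+ 1)) (cong (λ z → (ℤ.+ 1) ℤ.+ z) (ℤ.*-identityʳ (ℤ.+ n))))))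

clear-denominator : ∀ p → 0ℚ ℚ.≤ p → ∃ λ w → ι (↧ₙ p) ℚ.* p ≡ ι w
clear-denominator p@(mkℚ (ℤ.+ w) d _) _ = w , toℚᵘ-injective
  (≃-trans (toℚᵘ-homo-* (ι (suc d)) p) (≃-trans (ℚᵘ.*-congʳ {toℚᵘ p} (toℚᵘ-ι (suc d)))
    (≃-trans (*≡* equation) (≃-sym (toℚᵘ-ι w)))))
  where
  equation : ((ℤ.+ suc d) ℤ.* (ℤ.+ w)) ℤ.* (ℤ.+ 1) ≡ (ℤ.+ w) ℤ.* (ℤ.+ (1 ℕ.* suc d))
  equation = trans (ℤ.*-identityʳ _) (trans (ℤ.*-comm (ℤ.+ suc d) (ℤ.+ w))
    (cong (λ e → (ℤ.+ w) ℤ.* (ℤ.+ e)) (sym (ℕ.*-identityˡ (suc d)))))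
clear-denominator (mkℚ -[1+ w ] d _) (ℚ.*≤* ())

clear-multiple : ∀ {N} p → ↧ₙ p ∣ N → 0ℚ ℚ.≤ p → ∃ λ w → ι N ℚ.* p ≡ ι w
clear-multiple p (divides q refl) 0≤p with clear-denominator p 0≤p
... | w , h = q ℕ.* w , (begin
  ι (q ℕ.* ↧ₙ p) ℚ.* p        ≡⟨ cong (ℚ._* p) (ι-* q (↧ₙ p)) ⟩
  (ι q ℚ.* ι (↧ₙ p)) ℚ.* p    ≡⟨ ℚ.*-assoc (ι q) (ι (↧ₙ p)) p ⟩
  ι q ℚ.* (ι (↧ₙ p) ℚ.* p)    ≡⟨ cong (ι q ℚ.*_) h ⟩
  ι q ℚ.* ι w                 ≡⟨ ι-* q w ⟨
  ι (q ℕ.* w)                 ∎)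
  where open ≡-Reasoning

count-zero : ∀ {N} (p : Fin N → Bool) → count p ≡ 0 → ∀ i → ¬ T (p i)
count-zero p h zero with p zero
... | false = λ ()
count-zero {suc N} p h (suc i) = count-zero (p ∘ suc) (ℕ.m+n≡0⇒n≡0 (𝟙 (p zero)) h) i

fibre↔count : ∀ {N} {D : Set} (F : Fin N → D) (_≟_ : DecidableEquality D) d →
              Fibre F d ↔ Fin (count (λ i → ⌊ F i ≟ d ⌋))
fibre↔count F _≟_ d = proj₂ (finite-ΣFin _ (λ i → T ⌊ F i ≟ d ⌋) (λ i → finite-T ⌊ F i ≟ d ⌋)) ↔-∘
  Σ-restrict (↔-id _) (λ { _ refl refl → refl }) (λ _ → T-irrelevant) (λ _ → fromWitness) (λ _ → toWitness)

module _ {D : Set} where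
  countL : (D → Bool) → List D → ℕ
  countL d xs = count (d ∘ List.lookup xs)

  -- The multiset with multiplicities `w`, written as a list; its positions serve as the index set
  -- of a uniform law.
  weighted : (D → Bool) → (D → ℕ) → List D → List D
  weighted c w = concatMap (λ g → if c g then List.replicate (w g) g else [])

  countL-++ : ∀ d xs ys → countL d (xs ++ ys) ≡ countL d xs + countL d ys
  countL-++ d [] ys = refl
  countL-++ d (x ∷ xs) ys = trans (cong (𝟙 (d x) +_) (countL-++ d xs ys)) (sym (ℕ.+-assoc (𝟙 (d x)) _ _))

  countL-replicate : ∀ d k x → countL d (List.replicate k x) ≡ (if d x then k else 0)
  countL-replicate d zero x with d x
  ... | true = refl
  ... | false = refl
  countL-replicate d (suc k) x with d x | countL-replicate d k x
  ... | true | ih = cong suc ih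
  ... | false | ih = ih

  countL-weighted : ∀ c w d gs → countL d (weighted c w gs) ≡ sumℕ (λ g → c g ∧ d g) w gs
  countL-weighted c w d [] = refl
  countL-weighted c w d (g ∷ gs) with c g
  ... | false = countL-weighted c w d gs
  ... | true = trans (countL-++ d (List.replicate (w g) g) _)
      (trans (cong₂ _+_ (countL-replicate d (w g) g) (countL-weighted c w d gs)) (by (d g)))
    where
    rest = sumℕ (λ g → c g ∧ d g) w gs
    by : ∀ b → (if b then w g else 0) + rest ≡ (if b then w g + rest else rest)
    by true = refl
    by false = refl

  sumℕ-zero : (c : D → Bool) (w : D → ℕ) (gs : List D) → (∀ g → T (c g) → w g ≡ 0) → sumℕ c w gs ≡ 0
  sumℕ-zero c w gs h = trans (sumℕ-cong {c = c} {w} gs h) (sumℕ-0 {c = c} gs)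

  length-weighted : ∀ c w gs → length (weighted c w gs) ≡ sumℕ c w gs
  length-weighted c w gs = trans (sym (count-true _)) (trans (countL-weighted c w (const true) gs) (drop gs))
    where
    drop : ∀ gs → sumℕ (λ g → c g ∧ true) w gs ≡ sumℕ c w gs
    drop [] = refl
    drop (g ∷ gs) with c g
    ... | true = cong (w g +_) (drop gs)
    ... | false = drop gs

  lookup-weighted : ∀ c w gs i → T (c (List.lookup (weighted c w gs) i)) × w (List.lookup (weighted c w gs) i) ≢ 0
  lookup-weighted c w gs i = holds , λ z → absent (λ g → ⌊ w g ℕ.≟ 0 ⌋)
      (λ g t → toWitness (proj₂ (Equivalence.to (T-∧ {c g}) t))) (fromWitness z)
    where
    x = List.lookup (weighted c w gs) i
    absent : ∀ d → (∀ g → T (c g ∧ d g) → w g ≡ 0) → ¬ T (d x)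
    absent d h = count-zero (d ∘ List.lookup (weighted c w gs))
      (trans (countL-weighted c w d gs) (sumℕ-zero (λ g → c g ∧ d g) w gs h)) i
    contradictory : ∀ b → ¬ T (b ∧ not b)
    contradictory true ()
    contradictory false ()
    holds : T (c x)
    holds with c x in eq
    ... | true = _
    ... | false = ⊥-elim (absent (not ∘ c) (λ g t → ⊥-elim (contradictory (c g) t)) (Equivalence.from T-not-≡ eq))

module FromSA {m : ℕ} {ar : Fin m → ℕ} (𝕏 𝔸 : FinStr m ar) (k : ℕ) (1≤k : 1 ≤ k)
              (nonempty-rels : NonEmptyRels 𝔸) (sol : SAFeasible 𝕏 𝔸 k) where
  open PartialMaps 𝕏 𝔸 k
  open SA.Solution sol renaming (support to q-support)

  Variable : Set
  Variable = PMap ⊎ Σ (Fin m) λ R → Vec (Fin n) (ar R) × PMap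

  finite-PMap : Finite PMap
  finite-PMap = finite-Vec (finite-↔ (mk↔ₛ′ (λ { nothing → inj₁ zero ; (just x) → inj₂ x })
    (λ { (inj₁ _) → nothing ; (inj₂ x) → just x }) (λ { (inj₁ zero) → refl ; (inj₂ _) → refl })
    (λ { nothing → refl ; (just _) → refl })) (finite-⊎ (finite-Fin 1) (finite-Fin a))) n

  value : Variable → ℚ
  value (inj₁ g) = p g
  value (inj₂ (R , x , g)) = q R x g

  abstract
    common : ∃ λ N → NonZero N × (∀ v → ↧ₙ (value v) ∣ N)
    common = commonMultiple
      (finite-⊎ finite-PMap (finite-Σ (finite-Fin m) λ R → finite-× (finite-Vec (finite-Fin n) _) finite-PMap))
      (↧ₙ_ ∘ value) (λ v → _)

  N = proj₁ common
  open Scaled N (proj₁ (proj₂ common))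

  -- `p` and `q` are total functions, and at arguments that index no variable of the relaxation
  -- their values may be negative; such values get weight 0.
  weightAt : ∀ v → Dec (0ℚ ℚ.≤ value v) → ℕ
  weightAt v (yes h) = proj₁ (clear-multiple (value v) (proj₂ (proj₂ common) v) h)
  weightAt v (no _)  = 0

  weight : Variable → ℕ
  weight v = weightAt v (0ℚ ℚ.≤? value v)

  scale-weight : ∀ v → 0ℚ ℚ.≤ value v → ι N ℚ.* value v ≡ ι (weight v)
  scale-weight v 0≤ with 0ℚ ℚ.≤? value v
  ... | yes h = proj₂ (clear-multiple (value v) (proj₂ (proj₂ common) v) h)
  ... | no ¬h = ⊥-elim (¬h 0≤)

  wP : PMap → ℕ
  wP g = weight (inj₁ g)

  wQ : ∀ R → Vec (Fin n) (ar R) → PMap → ℕ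
  wQ R x g = weight (inj₂ (R , x , g))

  scale-p : ∀ {V} → 1 ≤ ∣ V ∣ → ∣ V ∣ ≤ k → ∀ g → dom g ≡ V → ι N ℚ.* p g ≡ ι (wP g)
  scale-p 1≤ ≤k g refl = scale-weight (inj₁ g) (proj₁ (p-range g 1≤ ≤k))

  scale-q : ∀ R x → T (FinStr.relF 𝕏 R x) → ∀ g → dom g ≡ entries x → ι N ℚ.* q R x g ≡ ι (wQ R x g)
  scale-q R x t g e = scale-weight (inj₂ (R , x , g)) (proj₁ (q-range R x t g e))

  sum-weight : ∀ c f w → (∀ g → T (c g) → ι N ℚ.* f g ≡ ι (w g)) → ∀ {w₀ r} → ι N ℚ.* r ≡ ι w₀ →
               r ≡ sumOver c f → sumℕ c w allPMaps ≡ w₀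
  sum-weight c f w h h₀ r≡ = ι-injective (trans (sym (scale-sum c f w allPMaps h))
    (trans (cong (ι N ℚ.*_) (sym r≡)) h₀))

  supported : Subset n → (PMap → ℕ) → List PMap
  supported V w = weighted (λ g → dom g =S V) w allPMaps

  dom-supported : ∀ V w i → dom (List.lookup (supported V w) i) ≡ V
  dom-supported V w i = toWitness (proj₁ (lookup-weighted (λ g → dom g =S V) w allPMaps i))

  length-supported : ∀ V → 1 ≤ ∣ V ∣ → ∣ V ∣ ≤ k → length (supported V wP) ≡ N
  length-supported V 1≤ ≤k = trans (length-weighted _ wP allPMaps)
    (sum-weight (λ g → dom g =S V) p wP (λ g t → scale-p 1≤ ≤k g (toWitness t)) scale-1 (sym (sum-one V 1≤ ≤k)))

  Marginal : Subset n → Subset n → (PMap → ℕ) → Set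
  Marginal U W w = ∀ f → dom f ≡ U → sumℕ (λ g → (dom g =S W) ∧ (restrict U g =P f)) w allPMaps ≡ wP f

  marginal-p : ∀ U V → 1 ≤ ∣ U ∣ → U ⊆ V → ∣ V ∣ ≤ k → Marginal U V wP
  marginal-p U V 1≤ U⊆V ≤k f e = sum-weight _ p wP
    (λ g t → scale-p (≤-trans 1≤ (p⊆q⇒∣p∣≤∣q∣ U⊆V)) ≤k g (toWitness (proj₁ (Equivalence.to (T-∧ {dom g =S V}) t))))
    (scale-p 1≤ (≤-trans (p⊆q⇒∣p∣≤∣q∣ U⊆V) ≤k) f e) (marg U V 1≤ U⊆V ≤k f e)

  marginal-q : ∀ R x → T (FinStr.relF 𝕏 R x) → ∀ U → 1 ≤ ∣ U ∣ → U ⊆ entries x → ∣ U ∣ ≤ k →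
               Marginal U (entries x) (wQ R x)
  marginal-q R x t U 1≤ U⊆ ≤k f e = sum-weight _ (q R x) (wQ R x)
    (λ g s → scale-q R x t g (toWitness (proj₁ (Equivalence.to (T-∧ {dom g =S entries x}) s))))
    (scale-p 1≤ ≤k f e) (margC R x t U 1≤ U⊆ ≤k f e)

  -- Fibres over each `d` are compared by size. Both have size `wP d` when `d` has domain `U` and
  -- are empty otherwise; the right-hand side is the case `W = U` of the same computation, where
  -- restriction changes nothing.
  marginal⇒matching : ∀ U W w → 1 ≤ ∣ U ∣ → ∣ U ∣ ≤ k → U ⊆ W → Marginal U W w →
    Matching λ i j → restrict U (List.lookup (supported W w) i) ≡ List.lookup (supported U wP) j
  marginal⇒matching U W w 1≤ ≤k U⊆W marginal =
    fibres⇒matching (restrict U ∘ List.lookup L) (List.lookup L′) λ d →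
      ↔-sym (fibre↔count (List.lookup L′) dec d) ↔-∘
        (subst (λ l → Fin (count (λ i → restrict U (List.lookup L i) =P d)) ↔ Fin l) (equal d) (↔-id _) ↔-∘
         fibre↔count (restrict U ∘ List.lookup L) dec d)
    where
    dec = ≡-dec (Maybe-≡-dec F._≟_)
    L = supported W w
    L′ = supported U wP
    counted : ∀ {W} w → U ⊆ W → Marginal U W w → ∀ d →
              count (λ i → restrict U (List.lookup (supported W w) i) =P d) ≡ (if dom d =S U then wP d else 0)
    counted {W} w U⊆W marginal d =
      trans (countL-weighted (λ g → dom g =S W) w (λ g → restrict U g =P d) allPMaps) eq
      where
      eq : sumℕ (λ g → (dom g =S W) ∧ (restrict U g =P d)) w allPMaps ≡ (if dom d =S U then wP d else 0)
      eq with ≡-dec Bool._≟_ (dom d) U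
      ... | yes e = marginal d e
      ... | no ¬e = sumℕ-zero (λ g → (dom g =S W) ∧ (restrict U g =P d)) w allPMaps λ g t →
        let t₁ , t₂ = Equivalence.to (T-∧ {dom g =S W} {restrict U g =P d}) t in
        ⊥-elim (¬e (trans (cong dom (sym (toWitness t₂)))
          (dom-restrict (λ y∈ → subst (_ ∈ₛ_) (sym (toWitness t₁)) (U⊆W y∈)))))
    restricted : ∀ j → restrict U (List.lookup L′ j) ≡ List.lookup L′ j
    restricted j = trans (cong (λ V → restrict V (List.lookup L′ j)) (sym (dom-supported U wP j))) restrict-dom
    equal : ∀ d → count (λ i → restrict U (List.lookup L i) =P d) ≡ count (λ j → List.lookup L′ j =P d)
    equal d = trans (counted w U⊆W marginal d) (trans
      (sym (counted wP (λ y → y) (marginal-p U U 1≤ (λ y → y) ≤k) d))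
      (count-cong (λ j → cong (_=P d) (restricted j))))

  -- A list of the wrong length yields the empty partial map. For a constraint of arity 0 this is a
  -- correct value, as the only map on the empty set.
  sampleAt : ∀ L → Dec (length L ≡ N) → Fin N → PMap
  sampleAt L (yes e) s = List.lookup L (subst Fin (sym e) s)
  sampleAt L (no _)  s = replicate n nothing

  sample : List PMap → Fin N → PMap
  sample L = sampleAt L (length L ℕ.≟ N)

  sample-lookup : ∀ L → length L ≡ N → Matching λ s i → sample L s ≡ List.lookup L i
  sample-lookup L e with length L ℕ.≟ N
  ... | yes e' = subst (λ l → (e : l ≡ N) → (ℓ : Fin l → PMap) → Matching λ s i → ℓ (subst Fin (sym e) s) ≡ ℓ i) (sym e')
                   (λ { refl _ → ↔-id _ , λ _ → refl }) e' (List.lookup L)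
  ... | no ¬e = ⊥-elim (¬e e)

  sample-matching : ∀ L L' U → length L' ≡ N →
    (Matching λ i j → restrict U (List.lookup L i) ≡ List.lookup L' j) →
    Matching λ s s' → restrict U (sample L s) ≡ sample L' s'
  sample-matching L L' U e' match =
    ↔-sym ψ' ↔-∘ (proj₁ match ↔-∘ ψ) , λ s → let i = to ψ s ; j = to (proj₁ match) i in
      trans (cong (restrict U) (h s)) (trans (proj₂ match i)
        (sym (trans (h' (from ψ' j)) (cong (List.lookup L') (to-from ψ' j)))))
    where
    e : length L ≡ N
    e = trans (finite-↔⇒card≡ (finite-Fin _) (finite-Fin _) (proj₁ match)) e'
    ψ = proj₁ (sample-lookup L e)
    h = proj₂ (sample-lookup L e)
    ψ' = proj₁ (sample-lookup L' e')
    h' = proj₂ (sample-lookup L' e')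

  G : Subset n → Fin N → PMap
  G V = sample (supported V wP)

  L : ∀ R → Vec (Fin n) (ar R) → List PMap
  L R x = supported (entries x) (wQ R x)

  -- The relaxation has no normalisation for `q`. The total mass is read off from the marginal on a
  -- singleton inside `entries x`, which is available since `k` is at least 1.
  length-L : ∀ R x → T (FinStr.relF 𝕏 R x) → Nonempty (entries x) → length (L R x) ≡ N
  length-L R x t (y , y∈) = trans
    (finite-↔⇒card≡ (finite-Fin _) (finite-Fin _) (proj₁ (marginal⇒matching ⁅ y ⁆ (entries x) (wQ R x) 1≤ ≤k ⊆x
      (marginal-q R x t ⁅ y ⁆ 1≤ ⊆x ≤k))))
    (length-supported ⁅ y ⁆ 1≤ ≤k)
    where
    1≤ : 1 ≤ ∣ ⁅ y ⁆ ∣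
    1≤ = ℕ.≤-reflexive (sym (∣⁅x⁆∣≡1 y))
    ≤k : ∣ ⁅ y ⁆ ∣ ≤ k
    ≤k = subst (_≤ k) (sym (∣⁅x⁆∣≡1 y)) 1≤k
    ⊆x : ⁅ y ⁆ ⊆ entries x
    ⊆x z∈ = subst (_∈ₛ entries x) (sym (x∈⁅y⁆⇒x≡y y z∈)) y∈

  -- When R has arity 0 the relaxation does not constrain the total mass of q R x.
  sample-L : ∀ R x → T (FinStr.relF 𝕏 R x) → ∀ s →
             (∃ λ i → sample (L R x) s ≡ List.lookup (L R x) i) ⊎
             (¬ Nonempty (entries x) × sample (L R x) s ≡ replicate n nothing)
  sample-L R x t s with length (L R x) ℕ.≟ N | length-L R x t
  ... | yes e | _ = inj₁ (_ , refl)
  ... | no ¬e | h = inj₂ (¬e ∘ h , refl)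

  dom-H : ∀ R x t s → dom (sample (L R x) s) ≡ entries x
  dom-H R x t s with sample-L R x t s
  ... | inj₁ (i , e) = trans (cong dom e) (dom-supported (entries x) (wQ R x) i)
  ... | inj₂ (empty , e) = trans (cong dom e) (subset-ext
    (λ {y} y∈ → ⊥-elim (nowhere (trans (sym (lookup-replicate y nothing)) (proj₂ (∈-dom⁻ y∈)))))
    (λ y∈ → ⊥-elim (empty (_ , y∈))))
    where
    nowhere : ∀ {x : Fin a} → nothing ≢ just x
    nowhere ()

  empty⇒≡ : ∀ {r} (x : Vec (Fin n) r) → ¬ Nonempty (entries x) → (b b' : Vec (Fin a) r) → b ≡ b'
  empty⇒≡ []      _     []  [] = refl
  empty⇒≡ (y ∷ x) empty _   _  = ⊥-elim (empty (y , ∈-entries⁺ (y ∷ x) zero refl))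

  support : ∀ R x t s (h : Vec (Fin a) (ar R)) → map just h ≡ map (lookup (sample (L R x) s)) x →
            T (FinStr.relF 𝔸 R h)
  support R x t s h h≡ with sample-L R x t s
  -- Without entries the arity is 0, so the tuple supplied by nonemptiness of the relation is `h`
  -- itself.
  ... | inj₂ (empty , _) = let b , r = nonempty-rels R in subst (T ∘ FinStr.relF 𝔸 R) (empty⇒≡ x empty b h) r
  ... | inj₁ (i , e) with FinStr.relF 𝔸 R h in h∉
  ...   | true = _
  -- A forbidden `h` forces the value of `q`, hence the weight, to be zero, whereas every listed
  -- partial map has nonzero weight.
  ...   | false = ⊥-elim (proj₂ (lookup-weighted (λ g → dom g =S entries x) (wQ R x) allPMaps i)
    (ι-injective (begin
    ι (wQ R x g)     ≡⟨ scale-q R x t g dom-g ⟨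
    ι N ℚ.* q R x g  ≡⟨ cong (ι N ℚ.*_) (q-support R x t g dom-g h (trans h≡ (cong (λ g → map (lookup g) x) e)) h∉) ⟩
    ι N ℚ.* 0ℚ       ≡⟨ scale-0 ⟩
    ι 0              ∎)))
    where
    open ≡-Reasoning
    g = List.lookup (L R x) i
    dom-g = dom-supported (entries x) (wQ R x) i

  randomAssignment : RandomAssignment 𝕏 𝔸 k
  randomAssignment = record
    { N = N
    ; N≢0 = proj₁ (proj₂ common)
    ; G = G
    ; H = λ R x _ → sample (L R x)
    ; dom-G = λ V 1≤ ≤k s → let ψ , h = sample-lookup (supported V wP) (length-supported V 1≤ ≤k) in
        trans (cong dom (h s)) (dom-supported V wP (to ψ s))
    ; dom-H = dom-H
    ; marg-G = λ U V 1≤ U⊆V ≤k → let ≤k′ = ≤-trans (p⊆q⇒∣p∣≤∣q∣ U⊆V) ≤k in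
        sample-matching (supported V wP) (supported U wP) U (length-supported U 1≤ ≤k′)
          (marginal⇒matching U V wP 1≤ ≤k′ U⊆V (marginal-p U V 1≤ U⊆V ≤k))
    ; marg-H = λ R x t U 1≤ U⊆ ≤k →
        sample-matching (L R x) (supported U wP) U (length-supported U 1≤ ≤k)
          (marginal⇒matching U (entries x) (wQ R x) 1≤ ≤k U⊆ (marginal-q R x t U 1≤ U⊆ ≤k))
    ; support = support }

-- From random assignments to coherent random homomorphisms

module ToBagHom {m : ℕ} {ar : Fin m → ℕ} (𝕏 𝔸 : FinStr m ar) (k : ℕ) (ra : RandomAssignment 𝕏 𝔸 k) where
  open PartialMaps 𝕏 𝔸 k
  open RandomAssignment ra
  module X = StarProperties 𝕏 k
  module A = StarProperties 𝔸 k
  open Star 𝕏 k using (tup; con) renaming (U* to X*)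
  open Star 𝔸 k using () renaming (tup to tupA; con to conA; U* to A*)

  1≤entries : ∀ j (z : Vec (Fin n) (len {k} j)) → 1 ≤ ∣ entries z ∣
  1≤entries j z = entries-nonempty z

  entries≤k : ∀ j (z : Vec (Fin n) (len {k} j)) → ∣ entries z ∣ ≤ k
  entries≤k j z = ≤-trans (∣entries∣≤ z) (Fin.toℕ<n j)

  entries⊆ : ∀ {r} {z : Vec (Fin n) r} {g} → dom g ≡ entries z → entries z ⊆ dom g
  entries⊆ e = subst (_ ∈ₛ_) (sym e)

  tupleValues : ∀ j (z : Vec (Fin n) (len {k} j)) s →
                Σ (Vec (Fin a) (len j)) λ b → ∀ i → lookup (G (entries z) s) (lookup z i) ≡ just (lookup b i)
  tupleValues j z s = values z _ (entries⊆ {z = z} (dom-G (entries z) (1≤entries j z) (entries≤k j z) s))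

  conValues : ∀ R x t s → Σ (Vec (Fin a) (ar R)) λ b → ∀ i → lookup (H R x t s) (lookup x i) ≡ just (lookup b i)
  conValues R x t s = values x _ (entries⊆ {z = x} (dom-H R x t s))

  conValues-rel : ∀ R x t s → T (FinStr.relF 𝔸 R (proj₁ (conValues R x t s)))
  conValues-rel R x t s = support R x t s b (vec-ext λ i →
    trans (lookup-map i just b) (trans (sym (proj₂ (conValues R x t s) i)) (sym (lookup-map i (lookup (H R x t s)) x))))
    where b = proj₁ (conValues R x t s)

  values-eqOn : ∀ {r} (z : Vec (Fin n) r) (b : Vec (Fin a) r) (g : PMap) →
                (∀ i → lookup g (lookup z i) ≡ just (lookup b i)) → ∀ S → EqOn S z → EqOn S b
  values-eqOn z b g h S e i i' i∈ i'∈ = just-injective (trans (sym (h i))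
    (trans (cong (lookup g) (e i i' i∈ i'∈)) (h i')))

  values-π : ∀ {r r'} (ι : Vec (Fin r) r') (z : Vec (Fin n) r) (b : Vec (Fin a) r) (b' : Vec (Fin a) r')
             (g g' : PMap) → (∀ i → lookup g (lookup z i) ≡ just (lookup b i)) →
             (∀ i → lookup g' (lookup (π ι z) i) ≡ just (lookup b' i)) →
             restrict (entries (π ι z)) g ≡ g' → π ι b ≡ b'
  values-π ι z b b' g g' h h' e = vec-ext λ i → just-injective (begin
    just (lookup (π ι b) i)                               ≡⟨ cong just (lookup-π ι b i) ⟩
    just (lookup b (lookup ι i))                          ≡⟨ h (lookup ι i) ⟨
    lookup g (lookup z (lookup ι i))                      ≡⟨ cong (lookup g) (lookup-π ι z i) ⟨
    lookup g (lookup (π ι z) i)                           ≡⟨ lookup-restrict {g = g} (∈-entries⁺ (π ι z) i refl) ⟨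
    lookup (restrict (entries (π ι z)) g) (lookup (π ι z) i) ≡⟨ cong (λ g → lookup g (lookup (π ι z) i)) e ⟩
    lookup g' (lookup (π ι z) i)                          ≡⟨ h' i ⟩
    just (lookup b' i)                                    ∎)
    where open ≡-Reasoning

  P : X* → Fin N → A*
  P (tup j z)   s = tupA j (proj₁ (tupleValues j z s))
  P (con R x t) s = conA R (proj₁ (conValues R x t s)) (conValues-rel R x t s)

  -- Coherence of the lift needs the identity when U and V coincide.
  marginal : ∀ U V → Dec (U ≡ V) → 1 ≤ ∣ U ∣ → U ⊆ V → (∀ s → dom (G V s) ≡ V) → ∣ V ∣ ≤ k →
             Matching λ s s' → restrict U (G V s) ≡ G U s'
  marginal V .V (yes refl) 1≤ U⊆V dom≡ ≤k = ↔-id _ , λ s →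
    trans (cong (λ W → restrict W (G V s)) (sym (dom≡ s))) restrict-dom
  marginal U V (no _) 1≤ U⊆V dom≡ ≤k = marg-G U V 1≤ U⊆V ≤k

  marginal-≡ : ∀ U V d 1≤ (U⊆V : U ⊆ V) dom≡ ≤k → U ≡ V →
               ∀ s → to (proj₁ (marginal U V d 1≤ U⊆V dom≡ ≤k)) s ≡ s
  marginal-≡ V .V (yes refl) _ _ _ _ _ s = refl
  marginal-≡ U V (no U≢V) _ _ _ _ U≡V s = ⊥-elim (U≢V U≡V)

  marginal-π : ∀ j j' (ι : Vec (Fin (len {k} j)) (len {k} j')) z →
               Matching λ s s' → restrict (entries (π ι z)) (G (entries z) s) ≡ G (entries (π ι z)) s'
  marginal-π j j' ι z = marginal (entries (π ι z)) (entries z) (≡-dec Bool._≟_ _ _)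
    (1≤entries j' (π ι z)) (entries-π⊆ ι z) (dom-G (entries z) (1≤entries j z) (entries≤k j z)) (entries≤k j z)

  match-T₂ : ∀ j j' ι u v → T (Star.relT₂ 𝕏 k j j' ι u v) →
             Matching λ s s' → T (Star.relT₂ 𝔸 k j j' ι (P u s) (P v s'))
  match-T₂ j j' ι u v t with X.relT₂⁻ j j' ι u v t
  ... | z , refl , refl = proj₁ (marginal-π j j' ι z) , λ s →
    subst (λ b → T (Star.relT₂ 𝔸 k j j' ι (tupA j (proj₁ (tupleValues j z s))) (tupA j' b)))
      (values-π ι z (proj₁ (tupleValues j z s)) _ _ _ (proj₂ (tupleValues j z s))
        (proj₂ (tupleValues j' (π ι z) (to (proj₁ (marginal-π j j' ι z)) s)))
        (proj₂ (marginal-π j j' ι z) s))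
      (A.relT₂⁺ j j' ι _)

  -- Extracts the equality of entry sets from `tup j z ≡ tup j' (π ι z)` by congruence, where the
  -- equation itself cannot be solved for `z`.
  elementEntries : X* → Subset n
  elementEntries (tup j z)   = entries z
  elementEntries (con R x t) = entries x

  match-T₂-≡ : ∀ j j' ι u v t → u ≡ v → ∀ s → to (proj₁ (match-T₂ j j' ι u v t)) s ≡ s
  match-T₂-≡ j j' ι u v t u≡v s with X.relT₂⁻ j j' ι u v t
  ... | z , refl , refl = marginal-≡ (entries (π ι z)) (entries z) (≡-dec Bool._≟_ _ _) _ _ _ _
    (cong elementEntries (sym u≡v)) s

  match-R₂ : ∀ R j ι u v → T (Star.relR₂ 𝕏 k R j ι u v) →
             Matching λ s s' → T (Star.relR₂ 𝔸 k R j ι (P u s) (P v s'))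
  match-R₂ R j ι u v t with X.relR₂⁻ R j ι u v t
  ... | x , r , refl , refl = proj₁ marginal-x , λ s →
    subst (λ b → T (Star.relR₂ 𝔸 k R j ι (P (con R x r) s) (tupA j b)))
      (values-π ι x (proj₁ (conValues R x r s)) _ _ _ (proj₂ (conValues R x r s))
        (proj₂ (tupleValues j (π ι x) (to (proj₁ marginal-x) s)))
        (proj₂ marginal-x s))
      (A.relR₂⁺ R j ι _ (conValues-rel R x r s))
    where
    marginal-x : Matching λ s s' → restrict (entries (π ι x)) (H R x r s) ≡ G (entries (π ι x)) s'
    marginal-x = marg-H R x r (entries (π ι x)) (1≤entries j (π ι x)) (entries-π⊆ ι x) (entries≤k j (π ι x))

  match-R₂-≢ : ∀ R j ι u v → T (Star.relR₂ 𝕏 k R j ι u v) → u ≢ v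
  match-R₂-≢ R j ι u v t u≡v with X.relR₂⁻ R j ι u v t
  ... | x , r , refl , refl with () ← u≡v

  -- The first entry of a constraint keeps its index; a second entry follows it through the matching
  -- of the two marginals.
  τ : ∀ s (b : Vec X* (ar* s)) → T (Star.rel* 𝕏 k s b) → Fin (ar* s) → Fin N ↔ Fin N
  τ (T₂ j j' ι) (u ∷ v ∷ []) t (suc zero) = proj₁ (match-T₂ j j' ι u v t)
  τ (R₂ R j ι)  (u ∷ v ∷ []) t (suc zero) = proj₁ (match-R₂ R j ι u v t)
  τ (T₂ j j' ι) (u ∷ v ∷ []) t zero = ↔-id _
  τ (R₂ R j ι)  (u ∷ v ∷ []) t zero = ↔-id _
  τ (T₁ j S)    b t i = ↔-id _
  τ (R₁ R S)    b t i = ↔-id _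

  pres : ∀ s b t x → T (Star.rel* 𝔸 k s (tabulate λ i → P (lookup b i) (to (τ s b t i) x)))
  pres (T₁ j S) (u ∷ []) t s with X.relT₁⁻ j S u t
  ... | z , refl , e = A.relT₁⁺ j S _
    (values-eqOn z (proj₁ (tupleValues j z s)) (G (entries z) s) (proj₂ (tupleValues j z s)) S e)
  pres (T₂ j j' ι) (u ∷ v ∷ []) t s = proj₂ (match-T₂ j j' ι u v t) s
  pres (R₁ R S) (u ∷ []) t s with X.relR₁⁻ R S u t
  ... | x , r , refl , e = A.relR₁⁺ R S _ (conValues-rel R x r s)
    (values-eqOn x (proj₁ (conValues R x r s)) (H R x r s) (proj₂ (conValues R x r s)) S e)
  pres (R₂ R j ι) (u ∷ v ∷ []) t s = proj₂ (match-R₂ R j ι u v t) s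

  bagHom : BagHom (𝕏 *^ k) (𝔸 *^ k)
  bagHom = record
    { I = Fin N ; finite = finite-Fin N ; point = F.fromℕ< (ℕ.>-nonZero⁻¹ N {{N≢0}})
    ; P = P ; τ = τ ; pres = pres }

  coherent : Coherent (𝕏 *^ k) τ
  coherent (T₁ j S) b t i i' _ s = refl
  coherent (R₁ R S) b t i i' _ s = refl
  coherent (T₂ j j' ι) (u ∷ v ∷ []) t zero zero _ s = refl
  coherent (T₂ j j' ι) (u ∷ v ∷ []) t (suc zero) (suc zero) _ s = refl
  coherent (T₂ j j' ι) (u ∷ v ∷ []) t zero (suc zero) e s = sym (match-T₂-≡ j j' ι u v t e s)
  coherent (T₂ j j' ι) (u ∷ v ∷ []) t (suc zero) zero e s = match-T₂-≡ j j' ι u v t (sym e) s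
  coherent (R₂ R j ι) (u ∷ v ∷ []) t zero zero _ s = refl
  coherent (R₂ R j ι) (u ∷ v ∷ []) t (suc zero) (suc zero) _ s = refl
  coherent (R₂ R j ι) (u ∷ v ∷ []) t zero (suc zero) e s = ⊥-elim (match-R₂-≢ R j ι u v t e)
  coherent (R₂ R j ι) (u ∷ v ∷ []) t (suc zero) zero e s = ⊥-elim (match-R₂-≢ R j ι u v t (sym e))

-- The equivalences

threeStep⇒chain : ∀ {σ} {B C : Structure σ} → IsFinite C → ThreeStep B C → Chain B C
threeStep⇒chain fC (Y₁ , Y₂ , f₁ , f₂ , h₁ , e , h₂) =
  (f₁ , inj₁ h₁) ∷ ((f₂ , inj₂ e) ∷ ((fC , inj₁ h₂) ∷ []))

theorem7p4 : ∀ {m : ℕ} {ar : Fin m → ℕ} (𝕏 𝔸 : FinStr m ar) (k : ℕ) →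
    1 ≤ k → NonEmptyRels 𝕏 → NonEmptyRels 𝔸 →
    (SAFeasible 𝕏 𝔸 k ⇔ Chain (𝕏 *^ k) (𝔸 *^ k))
    × (SAFeasible 𝕏 𝔸 k ⇔ ThreeStep (𝕏 *^ k) (𝔸 *^ k))
theorem7p4 𝕏 𝔸 k 1≤k _ nonempty =
  mk⇔ (chain ∘ threeStep) feasible , mk⇔ threeStep (feasible ∘ chain)
  where
  chain : ThreeStep (𝕏 *^ k) (𝔸 *^ k) → Chain (𝕏 *^ k) (𝔸 *^ k)
  chain = threeStep⇒chain (StarProperties.finite-U* 𝔸 k)
  threeStep : SAFeasible 𝕏 𝔸 k → ThreeStep (𝕏 *^ k) (𝔸 *^ k)
  threeStep sol = coherent⇒threeStep finite-Sym* position (StarProperties.finite-U* 𝕏 k)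
    (ToBagHom.bagHom 𝕏 𝔸 k ra) (ToBagHom.coherent 𝕏 𝔸 k ra)
    where ra = FromSA.randomAssignment 𝕏 𝔸 k 1≤k nonempty sol
  feasible : Chain (𝕏 *^ k) (𝔸 *^ k) → SAFeasible 𝕏 𝔸 k
  feasible ys = ToSA.solution 𝕏 𝔸 k (FromBagHom.randomAssignment 𝕏 𝔸 k
    (chain⇒bagHom finite-Sym* position (StarProperties.finite-U* 𝕏 k) ys))
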